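{- Let $p,q,r\in\mathbb{N}$ (with $0\in\mathbb{N}$), and let $A,B\subset\mathbb{S}$ be finite disjoint sets with $|A|=n$, $|B|=m$, $n>m$. Let $C=\sum_{i=0}^{2^p-1} Z_{p,q,r}(A,B,i)$ be the number of collisions between the HyperMinHash sketches of $A$ and $B$. Then $$\mathbb{E}\,C \le 2^p\left(\frac{5}{2^r}+\frac{n}{2^{p+2^q+r}}\right).$$
   Context: $\mathbb{S}$ is a universe of hashable objects, and $h:\mathbb{S}\to[0,1]$ is a uniformly random hash function (random oracle, shared by all sets): the values $h(a)$, $a\in\mathbb{S}$, are independent and uniform on $[0,1]$. All expectations are over $h$. For $x\in(0,1)$ let $\rho_q(x)=\min(\lfloor-\log_2 x\rfloor+1,\,2^q)$ and $\sigma_r(x)=\lfloor x2^r\rfloor$. Define $\hat h_{q,r}(x)=\left(\rho_q(x),\ \sigma_r(x2^{\rho_q(x)}-1)\right)$ if $\rho_q(x)<2^q$, and $\hat h_{q,r}(x)=\left(2^q,\ \sigma_r(x2^{2^q-1})\right)$ if $\rho_q(x)=2^q$. Up to probability-zero boundary events, the values lie in $\{1,\dots,2^q\}\times\{0,\dots,2^r-1\}$, the second factor being identified with $\{0,1\}^r$. The HyperMinHash sketch of a finite set $A$ has $2^p$ buckets; for $i\in\{0,\dots,2^p-1\}$ the $i$th bucket is $$f_{p,q,r}(A)_i=\hat h_{q,r}\left[\min_{a\in A,\ i2^{ -p}<h(a)<(i+1)2^{ -p}}\left(h(a)2^p-i\right)\right].$$ If no $a\in A$ has $h(a)\in(i2^{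 -p},(i+1)2^{ -p})$, the bucket is called empty. For disjoint $A,B$, $Z_{p,q,r}(A,B,i)$ is the indicator of a collision in bucket $i$: it equals $1$ if bucket $i$ is nonempty for both $A$ and $B$ and $f_{p,q,r}(A)_i=f_{p,q,r}(B)_i$, and $0$ otherwise. -}

module Defs where

open import Level using (0ℓ)
open import Algebra.Bundles using (CommutativeRing)
import Algebra.Properties.Monoid.Sum as MonoidSum
import Algebra.Properties.Semiring.Exp as SemiringExp
import Algebra.Properties.Semiring.Mult as SemiringMult
open import Data.Fin.Base using (Fin; zero; suc; toℕ)
open import Data.Integer.Base as ℤ using (ℤ; +_; -[1+_])
import Data.Integer.Properties as ℤ
open import Data.List.Base as List using (List; []; _∷_; filter)
import Data.List.Extrema as Extrema
open import Data.Maybe.Base as Maybe using (Maybe; nothing; just)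
open import Data.Nat.Base as ℕ using (ℕ; zero; suc; z≤n; s≤s)
import Data.Nat.Properties as ℕ
open import Data.Product.Base using (∃; _,_) renaming (_×_ to _∧_)
open import Data.Product.Properties using (≡-dec)
open import Data.Vec.Functional using (Vector)
open import Function.Definitions using (Injective)
open import Relation.Binary.Bundles using (DecTotalOrder; StrictTotalOrder)
open import Relation.Binary.Core using (Rel)
open import Relation.Binary.PropositionalEquality.Core using (_≡_; _≢_)
import Relation.Binary.Properties.DecTotalOrder as DecTotalOrderProperties
open import Relation.Binary.Structures using (IsDecTotalOrder)
open import Relation.Nullary.Decidable using (yes; no; _×-dec_)
open import Relation.Nullary.Negation using (¬_)
import Relation.Unary as Unary
open Unary using (Pred; U; ∅; ∁; ⋃; ⋂; _≐_; _⊢_; Satisfiable)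

record OrderedField : Set₁ where
  field
    commutativeRing : CommutativeRing 0ℓ 0ℓ

  open CommutativeRing commutativeRing public renaming (Carrier to ℝ)

  infix 4 _≤_
  infix 8 _⁻¹

  field
    0≉1             : ¬ (0# ≈ 1#)
    _⁻¹             : ℝ → ℝ
    *-inverseʳ      : ∀ x → ¬ (x ≈ 0#) → x * x ⁻¹ ≈ 1#
    _≤_             : Rel ℝ 0ℓ
    isDecTotalOrder : IsDecTotalOrder _≈_ _≤_
    +-monoˡ-≤       : ∀ {x y} z → x ≤ y → x + z ≤ y + z
    *-nonneg        : ∀ {x y} → 0# ≤ x → 0# ≤ y → 0# ≤ x * y

  decTotalOrder : DecTotalOrder 0ℓ 0ℓ 0ℓ
  decTotalOrder = record { isDecTotalOrder = isDecTotalOrder }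

  module Order = DecTotalOrder decTotalOrder

  open DecTotalOrderProperties decTotalOrder public
    using (_<_; <-strictTotalOrder)

  open StrictTotalOrder <-strictTotalOrder public using (_<?_)

  open SemiringMult semiring public using (_×_)

  open SemiringExp semiring public using (_^_)

  open MonoidSum +-monoid public using (sum)

  product : ∀ {n} → Vector ℝ n → ℝ
  product = MonoidSum.sum *-monoid

  open Extrema Order.totalOrder public using (min)

  infixl 7 _/_

  _/_ : ℝ → ℝ → ℝ
  x / y = x * y ⁻¹

  fromℕ : ℕ → ℝ
  fromℕ n = n × 1#

  fromℤ : ℤ → ℝ
  fromℤ (+ n)    = fromℕ n
  fromℤ -[1+ n ] = - fromℕ (suc n)

  infix 9 2^_

  2^_ : ℤ → ℝ
  2^ (+ n)    = fromℕ 2 ^ n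
  2^ -[1+ n ] = (fromℕ 2 ^ suc n) ⁻¹

  IsUpperBound : Pred ℝ 0ℓ → ℝ → Set
  IsUpperBound Q u = ∀ y → Q y → y ≤ u

  IsLeastUpperBound : Pred ℝ 0ℓ → ℝ → Set
  IsLeastUpperBound Q s = IsUpperBound Q s ∧ (∀ u → IsUpperBound Q u → s ≤ u)

-- The classical real numbers: a Dedekind-complete ordered field, unique up to
-- isomorphism.  The floor and the binary logarithm are determined by the
-- axioms given for them (the logarithm on the positive reals only; elsewhere
-- it is arbitrary).
record Reals : Set₁ where
  field
    orderedField : OrderedField

  open OrderedField orderedField public

  field
    complete    : (Q : Pred ℝ 0ℓ) → Satisfiable Q → ∃ (IsUpperBound Q) →
                  ∃ (IsLeastUpperBound Q)

    ⌊_⌋         : ℝ → ℤ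
    ⌊x⌋≤x       : ∀ x → fromℤ ⌊ x ⌋ ≤ x
    x<⌊x⌋+1     : ∀ x → x < fromℤ ⌊ x ⌋ + 1#

    log₂        : ℝ → ℝ
    log₂-cong   : ∀ {x y} → x ≈ y → log₂ x ≈ log₂ y
    log₂-2      : log₂ (fromℕ 2) ≈ 1#
    log₂-*      : ∀ {x y} → 0# < x → 0# < y → log₂ (x * y) ≈ log₂ x + log₂ y
    log₂-mono-< : ∀ {x y} → 0# < x → x < y → log₂ x < log₂ y

module Probability (ℛ : Reals) where

  open Reals ℛ

  -- Events form a σ-algebra.  `ℙ` is defined on all predicates but constrained
  -- only on events.
  record ProbabilitySpace : Set₂ where
    field
      Ω           : Set
      Event       : Pred Ω 0ℓ → Set₁
      Event-resp  : ∀ {E F} → E ≐ F → Event E → Event F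
      Event-U     : Event U
      Event-∁     : ∀ {E} → Event E → Event (∁ E)
      Event-⋃     : (E : ℕ → Pred Ω 0ℓ) → (∀ k → Event (E k)) → Event (⋃ ℕ E)

      ℙ           : Pred Ω 0ℓ → ℝ
      ℙ-cong      : ∀ {E F} → Event E → Event F → E ≐ F → ℙ E ≈ ℙ F
      ℙ-nonneg    : ∀ {E} → Event E → 0# ≤ ℙ E
      ℙ-∅         : ℙ ∅ ≈ 0#
      ℙ-U         : ℙ U ≈ 1#
      ℙ-⋃         : (E : ℕ → Pred Ω 0ℓ) → (∀ k → Event (E k)) →
                    (∀ j k → j ≢ k → E j Unary.⊥ E k) →
                    IsLeastUpperBound
                      (λ y → ∃ λ n → y ≈ sum {n} (λ k → ℙ (E (toℕ k))))
                      (ℙ (⋃ ℕ E))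

  data Borel : Pred ℝ 0ℓ → Set₁ where
    halfLine   : ∀ t → Borel (_≤ t)
    resp       : ∀ {B C} → B ≐ C → Borel B → Borel C
    complement : ∀ {B} → Borel B → Borel (∁ B)
    union      : (B : ℕ → Pred ℝ 0ℓ) → (∀ k → Borel (B k)) → Borel (⋃ ℕ B)

  module _ (𝒫 : ProbabilitySpace) where

    open ProbabilitySpace 𝒫

    IsRandomVariable : (Ω → ℝ) → Set₁
    IsRandomVariable X = ∀ {B} → Borel B → Event (X ⊢ B)

    IsUniform[0,1] : (Ω → ℝ) → Set
    IsUniform[0,1] X = ∀ {s t} → 0# ≤ s → s ≤ t → t ≤ 1# →
                       ℙ (λ ω → s ≤ X ω ∧ X ω ≤ t) ≈ t - s

    Independent : {I : Set} → (I → Ω → ℝ) → Set₁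
    Independent {I} X =
      ∀ {k} (ι : Fin k → I) → Injective _≡_ _≡_ ι →
      (B : Fin k → Pred ℝ 0ℓ) → (∀ j → Borel (B j)) →
      ℙ (⋂ (Fin k) (λ j → X (ι j) ⊢ B j)) ≈ product (λ j → ℙ (X (ι j) ⊢ B j))

    record IsRandomHash {𝕊 : Set} (h : 𝕊 → Ω → ℝ) : Set₁ where
      field
        measurable  : ∀ a → IsRandomVariable (h a)
        0≤h         : ∀ a ω → 0# ≤ h a ω
        h≤1         : ∀ a ω → h a ω ≤ 1#
        uniform     : ∀ a → IsUniform[0,1] (h a)
        independent : Independent h

    -- The expectation of a random variable with values in {0, …, N}.
    𝔼 : ∀ {N} (X : Ω → ℕ) → (∀ ω → X ω ℕ.≤ N) → ℝ
    𝔼 {N} X X≤N =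
      sum {suc N} (λ k → fromℕ (toℕ k) * ℙ (λ ω → X ω ≡ toℕ k))

∑ : ∀ {n} → Vector ℕ n → ℕ
∑ = MonoidSum.sum ℕ.+-0-monoid

∑≤n : ∀ n (f : Vector ℕ n) → (∀ i → f i ℕ.≤ 1) → ∑ f ℕ.≤ n
∑≤n zero    f f≤1 = z≤n
∑≤n (suc n) f f≤1 =
  ℕ.+-mono-≤ (f≤1 zero) (∑≤n n (λ i → f (suc i)) (λ i → f≤1 (suc i)))

module HyperMinHash (ℛ : Reals) where

  open Reals ℛ

  ρ : ℕ → ℝ → ℤ
  ρ q x = (⌊ - log₂ x ⌋ ℤ.+ + 1) ℤ.⊓ + (2 ℕ.^ q)

  σ : ℕ → ℝ → ℤ
  σ r x = ⌊ x * 2^ (+ r) ⌋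

  -- At the points x = 2⁻ᵏ with 0 < k < 2 ^ q the second component is 2 ^ r,
  -- outside {0, …, 2 ^ r - 1}, so the value is left in ℤ.
  ĥ : ℕ → ℕ → ℝ → ℤ ∧ ℤ
  ĥ q r x with ρ q x ℤ.<? + (2 ℕ.^ q)
  ... | yes _ = ρ q x         , σ r (x * 2^ (ρ q x) - 1#)
  ... | no  _ = + (2 ℕ.^ q)   , σ r (x * 2^ (+ (2 ℕ.^ q ℕ.∸ 1)))

  minimum : List ℝ → Maybe ℝ
  minimum []       = nothing
  minimum (x ∷ xs) = just (min x xs)

  collide : Maybe (ℤ ∧ ℤ) → Maybe (ℤ ∧ ℤ) → ℕ
  collide (just u) (just v) with ≡-dec ℤ._≟_ ℤ._≟_ u v
  ... | yes _ = 1
  ... | no  _ = 0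
  collide _        _        = 0

  collide≤1 : ∀ x y → collide x y ℕ.≤ 1
  collide≤1 (just u) (just v) with ≡-dec ℤ._≟_ ℤ._≟_ u v
  ... | yes _ = s≤s z≤n
  ... | no  _ = z≤n
  collide≤1 (just _) nothing  = z≤n
  collide≤1 nothing  _        = z≤n

  -- Below, `h` is one realisation of the hash function.
  module _ {𝕊 : Set} (p q r : ℕ) (h : 𝕊 → ℝ) where

    InBucket : ℕ → Pred 𝕊 0ℓ
    InBucket i a = (fromℕ i * 2^ (ℤ.- + p) < h a) ∧
                   (h a < fromℕ (suc i) * 2^ (ℤ.- + p))

    inBucket? : ∀ i → Unary.Decidable (InBucket i)
    inBucket? i a = (fromℕ i * 2^ (ℤ.- + p) <? h a) ×-dec
                    (h a <? fromℕ (suc i) * 2^ (ℤ.- + p))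

    rescaledHashes : List 𝕊 → ℕ → List ℝ
    rescaledHashes A i =
      List.map (λ a → h a * 2^ (+ p) - fromℕ i) (filter (inBucket? i) A)

    -- An empty bucket is `nothing`.
    sketch : List 𝕊 → ℕ → Maybe (ℤ ∧ ℤ)
    sketch A i = Maybe.map (ĥ q r) (minimum (rescaledHashes A i))

    Z : List 𝕊 → List 𝕊 → ℕ → ℕ
    Z A B i = collide (sketch A i) (sketch B i)

    collisions : List 𝕊 → List 𝕊 → ℕ
    collisions A B = ∑ {2 ℕ.^ p} (λ i → Z A B (toℕ i))

    collisions≤2^p : ∀ A B → collisions A B ℕ.≤ 2 ℕ.^ p
    collisions≤2^p A B =
      ∑≤n (2 ℕ.^ p) _ (λ i → collide≤1 (sketch A (toℕ i)) (sketch B (toℕ i)))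

  module _ (𝒫 : Probability.ProbabilitySpace ℛ) {𝕊 : Set} where

    open Probability ℛ
    open ProbabilitySpace 𝒫

    𝔼-collisions : (p q r : ℕ) → (𝕊 → Ω → ℝ) → List 𝕊 → List 𝕊 → ℝ
    𝔼-collisions p q r h A B =
      𝔼 𝒫 (λ ω → collisions p q r (λ a → h a ω) A B)
          (λ ω → collisions≤2^p p q r (λ a → h a ω) A B)

  collisionBound : (p q r n : ℕ) → ℝ
  collisionBound p q r n =
    2^ (+ p) * (fromℕ 5 / 2^ (+ r) + fromℕ n / 2^ (+ (p ℕ.+ 2 ℕ.^ q ℕ.+ r)))

{-# OPTIONS --safe #-}
-- Rescale a bucket to (0,1).  The codes cut (0,1) into cells [s,t), and a
-- collision forces both minima into a common cell.  Since A and B are disjoint,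
-- the probability of this is (xⁿ - yⁿ)(xᵐ - yᵐ), where x = 1 - s/2ᵖ and
-- y = 1 - t/2ᵖ.  As n > m, this is at most (n/2)(x - y)(xⁿ⁺ᵐ⁻¹ - yⁿ⁺ᵐ⁻¹), which
-- telescopes over the 2ʳ equally long cells of one value of ρ.  The last value
-- ρ = 2^q contributes at most n / 2^(p + 2^q + r), and the value k + 1 < 2^q
-- at most 2⁻ʳ(F (k + 1) - F k), where F k = (1 - 2^(- p - k - 1))ⁿ; these
-- telescope once more, to at most 2⁻ʳ.
module Submission where

open import Defs
open import Level using (0ℓ)
open import Algebra.Bundles using (CommutativeRing)
import Algebra.Properties.CommutativeMonoid.Sum as CommutativeMonoidSum
import Algebra.Properties.Ring as RingProperties
import Algebra.Properties.Semiring.Exp as SemiringExp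
import Algebra.Properties.Semiring.Mult as SemiringMult
import Algebra.Properties.Semiring.Mult.TCOptimised as OptimisedMult
import Algebra.Solver.Ring as RingSolver
open import Algebra.Solver.Ring.AlmostCommutativeRing
open import Data.Fin.Base using (zero; suc; toℕ)
open import Data.Integer.Base as ℤ using (ℤ; +_; -[1+_]; _⊖_)
import Data.Integer.Properties as ℤ
open import Data.List.Base as List using (List; []; _∷_; _++_; length; filter; lookup)
import Data.List.Extrema as Extrema
open import Data.List.Membership.Propositional.Properties using (∈-lookup)
open import Data.List.Properties using (map-++; map-∘; map-id)
open import Data.List.Relation.Binary.Disjoint.Propositional using (Disjoint)
open import Data.List.Relation.Unary.All as All using (All; []; _∷_)
import Data.List.Relation.Unary.All.Properties as All
open import Data.List.Relation.Unary.AllPairs using (_∷_)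
open import Data.List.Relation.Unary.Any as Any using (Any; here; there)
open import Data.List.Relation.Unary.Unique.Propositional using (Unique)
import Data.List.Relation.Unary.Unique.Propositional.Properties as Unique
open import Data.Maybe.Base as Maybe using (nothing; just)
open import Data.Nat.Base as ℕ using (ℕ; zero; suc; z≤n; s≤s; _>_)
import Data.Nat.Properties as ℕ
open import Data.Product.Base using (∃; ∃₂; _,_; proj₁; proj₂; uncurry) renaming (_×_ to _∧_)
open import Data.Product.Properties using (≡-dec)
open import Data.Sum.Base using (_⊎_; inj₁; inj₂; [_,_])
open import Function.Base using (_∘_; id)
open import Function.Definitions using (Injective)
open import Relation.Binary.Definitions using (WeaklyDecidable)
open import Relation.Binary.PropositionalEquality.Core as ≡ using (_≡_; _≢_)
import Relation.Binary.Properties.DecTotalOrder as DecTotalOrderProperties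
import Relation.Binary.Reasoning.PartialOrder as PartialOrderReasoning
import Relation.Binary.Reasoning.Setoid as SetoidReasoning
open import Relation.Nullary.Decidable as Dec using (yes; no; ¬?; _⊎-dec_; _×-dec_; decidable-stable)
open import Relation.Nullary.Negation using (¬_; contradiction)
import Relation.Unary as Unary
open Unary using (Pred; U; ∅; ∁; ⋃; _∪_; _∩_; _⊆_; _≐_; _⊢_; Decidable)
open Probability using (ProbabilitySpace; IsRandomHash)
open HyperMinHash using (𝔼-collisions; collisionBound)

-- The factor x - y of the cell bound is constant within one value of ρ, which leaves only the
-- difference of one function at the two ends of the cell to be summed. The condition n > m enters
-- as xᵈ ≥ yᵈ with d = n - 1 - m ≥ 0, in `paired-powers`. The obstacle lies at the ends of the
-- intervals. Since -log₂ reverses the order, the value ρ = k + 1 < 2^q is taken on (2⁻ᵏ⁻¹, 2⁻ᵏ],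
-- closed on the right, while the floor in `σ` cuts cells closed on the left; at the right end a
-- further code 2ʳ appears. Such points are not discarded as null: each is moved into the cell that
-- starts there. Only half-lines are Borel by axiom, and uniformity concerns intervals. A collision
-- is therefore first shown to be exactly a finite union of cell events, which makes it an event.
-- The cell events are then enclosed in events built from "no hash lies in (0, t)", whose
-- probabilities independence gives as powers.

-- A ring solver with integer coefficients over any commutative ring.

module IntegerCoefficients {c ℓ} (R : CommutativeRing c ℓ) where

  open CommutativeRing R
  open OptimisedMult semiring
  open RingProperties ring
  open SetoidReasoning setoid

  -- The optimised multiple makes `1 × 1#` reduce to `1#` itself, so solver constants agree by
  -- computation with the `1#` written in goals.
  ⟦_⟧ : ℤ → Carrier
  ⟦ + n ⟧      = n × 1#
  ⟦ -[1+ n ] ⟧ = - (suc n × 1#)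

  private
    cancel : ∀ x y z → (x + y) - (x + z) ≈ y - z
    cancel x y z = begin
      (x + y) - (x + z)       ≈⟨ +-cong (+-comm x y) (sym (-‿+-comm x z)) ⟩
      (y + x) + (- x + - z)   ≈⟨ +-assoc y x _ ⟩
      y + (x + (- x + - z))   ≈⟨ +-congˡ (+-assoc x (- x) (- z)) ⟨
      y + ((x - x) + - z)     ≈⟨ +-congˡ (+-congʳ (-‿inverseʳ x)) ⟩
      y + (0# + - z)          ≈⟨ +-congˡ (+-identityˡ (- z)) ⟩
      y - z                   ∎

  ⊖-homo : ∀ m n → ⟦ m ⊖ n ⟧ ≈ m × 1# - n × 1#
  ⊖-homo zero    zero    = sym (-‿inverseʳ 0#)
  ⊖-homo zero    (suc n) = sym (+-identityˡ _)
  ⊖-homo (suc m) zero    = sym (trans (+-congˡ -0#≈0#) (+-identityʳ _))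
  ⊖-homo (suc m) (suc n) = begin
    ⟦ suc m ⊖ suc n ⟧                 ≡⟨ ≡.cong ⟦_⟧ (ℤ.[1+m]⊖[1+n]≡m⊖n m n) ⟩
    ⟦ m ⊖ n ⟧                         ≈⟨ ⊖-homo m n ⟩
    m × 1# - n × 1#                   ≈⟨ cancel 1# (m × 1#) (n × 1#) ⟨
    (1# + m × 1#) - (1# + n × 1#)     ≈⟨ +-cong (1+× m 1#) (-‿cong (1+× n 1#)) ⟨
    suc m × 1# - suc n × 1#           ∎

  -‿homo : ∀ i → ⟦ ℤ.- i ⟧ ≈ - ⟦ i ⟧
  -‿homo (+ zero)  = sym -0#≈0#
  -‿homo (+ suc n) = refl
  -‿homo -[1+ n ]  = sym (-‿involutive _)

  +-homo : ∀ i j → ⟦ i ℤ.+ j ⟧ ≈ ⟦ i ⟧ + ⟦ j ⟧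
  +-homo (+ m)      (+ n)      = ×-homo-+ 1# m n
  +-homo (+ m)      -[1+ n ]   = ⊖-homo m (suc n)
  +-homo -[1+ m ]   (+ n)      = trans (⊖-homo n (suc m)) (+-comm _ _)
  +-homo -[1+ m ]   -[1+ n ]   = begin
    - (suc (suc (m ℕ.+ n)) × 1#)         ≡⟨ ≡.cong (λ k → - (k × 1#)) (≡.cong suc (ℕ.+-suc m n)) ⟨
    - ((suc m ℕ.+ suc n) × 1#)           ≈⟨ -‿cong (×-homo-+ 1# (suc m) (suc n)) ⟩
    - (suc m × 1# + suc n × 1#)          ≈⟨ -‿+-comm _ _ ⟨
    - (suc m × 1#) + - (suc n × 1#)      ∎

  private
    pos-* : ∀ m j → ⟦ + m ℤ.* j ⟧ ≈ m × 1# * ⟦ j ⟧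
    pos-* m (+ n)    = begin
      ⟦ + m ℤ.* + n ⟧   ≡⟨ ≡.cong ⟦_⟧ (ℤ.pos-* m n) ⟨
      (m ℕ.* n) × 1#    ≈⟨ ×1-homo-* m n ⟩
      m × 1# * n × 1#   ∎
    pos-* m -[1+ n ] = begin
      ⟦ + m ℤ.* ℤ.- + suc n ⟧   ≡⟨ ≡.cong ⟦_⟧ (ℤ.neg-distribʳ-* (+ m) (+ suc n)) ⟨
      ⟦ ℤ.- (+ m ℤ.* + suc n) ⟧ ≈⟨ -‿homo (+ m ℤ.* + suc n) ⟩
      - ⟦ + m ℤ.* + suc n ⟧     ≈⟨ -‿cong (pos-* m (+ suc n)) ⟩
      - (m × 1# * suc n × 1#)   ≈⟨ -‿distribʳ-* _ _ ⟩
      m × 1# * - (suc n × 1#)   ∎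

  *-homo : ∀ i j → ⟦ i ℤ.* j ⟧ ≈ ⟦ i ⟧ * ⟦ j ⟧
  *-homo (+ m)    j = pos-* m j
  *-homo -[1+ m ] j = begin
    ⟦ ℤ.- + suc m ℤ.* j ⟧     ≡⟨ ≡.cong ⟦_⟧ (ℤ.neg-distribˡ-* (+ suc m) j) ⟨
    ⟦ ℤ.- (+ suc m ℤ.* j) ⟧   ≈⟨ -‿homo (+ suc m ℤ.* j) ⟩
    - ⟦ + suc m ℤ.* j ⟧       ≈⟨ -‿cong (pos-* (suc m) j) ⟩
    - (suc m × 1# * ⟦ j ⟧)    ≈⟨ -‿distribˡ-* _ _ ⟩
    - (suc m × 1#) * ⟦ j ⟧    ∎

  morphism : ℤ.+-*-rawRing -Raw-AlmostCommutative⟶ fromCommutativeRing R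
  morphism = record
    { ⟦_⟧    = ⟦_⟧
    ; +-homo = +-homo
    ; *-homo = *-homo
    ; -‿homo = -‿homo
    ; 0-homo = refl
    ; 1-homo = refl
    }

  -- Only soundness is asked for: distinct integers are reported as unknown, since they may coincide
  -- in a ring of positive characteristic.
  equal? : WeaklyDecidable (Induced-equivalence morphism)
  equal? i j with i ℤ.≟ j
  ... | yes i≡j = just (reflexive (≡.cong ⟦_⟧ i≡j))
  ... | no  _   = nothing

  open RingSolver ℤ.+-*-rawRing (fromCommutativeRing R) morphism equal? public
    using (Polynomial; con; solve; _:=_; _:+_; _:*_; _:-_; :-_)

  :0 :1 :2 : ∀ {n} → Polynomial n
  :0 = con (+ 0)
  :1 = con (+ 1)
  :2 = :1 :+ :1

-- Inequalities in an ordered field, and powers of two.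

module OrderedFieldProperties (F : OrderedField) where

  open OrderedField F
  open DecTotalOrderProperties decTotalOrder public
    using (<⇒≱; ≰⇒>; ≮⇒≥)
  open IntegerCoefficients commutativeRing public
    using (solve; _:=_; _:+_; _:*_; _:-_; :-_; :0; :1; :2)
  open PartialOrderReasoning Order.poset

  x≤y⇒0≤y-x : ∀ {x y} → x ≤ y → 0# ≤ y - x
  x≤y⇒0≤y-x {x} {y} x≤y = begin
    0#     ≈⟨ -‿inverseʳ x ⟨
    x - x  ≤⟨ +-monoˡ-≤ (- x) x≤y ⟩
    y - x  ∎

  -- Many inequalities below take this form: an expression is visibly nonnegative, and the ring
  -- solver identifies it with the difference.
  ≤-by : ∀ {x y z} → 0# ≤ z → y - x ≈ z → x ≤ y
  ≤-by {x} {y} {z} 0≤z y-x≈z = begin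
    x            ≈⟨ +-identityˡ x ⟨
    0# + x       ≤⟨ +-monoˡ-≤ x 0≤z ⟩
    z + x        ≈⟨ +-congʳ y-x≈z ⟨
    y - x + x    ≈⟨ solve 2 (λ x y → y :- x :+ x := y) refl x y ⟩
    y            ∎

  +-mono-≤ : ∀ {x y z w} → x ≤ y → z ≤ w → x + z ≤ y + w
  +-mono-≤ {x} {y} {z} {w} x≤y z≤w = begin
    x + z  ≤⟨ +-monoˡ-≤ z x≤y ⟩
    y + z  ≈⟨ +-comm y z ⟩
    z + y  ≤⟨ +-monoˡ-≤ y z≤w ⟩
    w + y  ≈⟨ +-comm w y ⟩
    y + w  ∎

  +-nonneg : ∀ {x y} → 0# ≤ x → 0# ≤ y → 0# ≤ x + y
  +-nonneg {x} {y} 0≤x 0≤y = begin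
    0#      ≈⟨ +-identityˡ 0# ⟨
    0# + 0# ≤⟨ +-mono-≤ 0≤x 0≤y ⟩
    x + y   ∎

  *-monoˡ-≤ : ∀ {x y z} → 0# ≤ z → x ≤ y → z * x ≤ z * y
  *-monoˡ-≤ {x} {y} {z} 0≤z x≤y = ≤-by (*-nonneg 0≤z (x≤y⇒0≤y-x x≤y))
    (solve 3 (λ x y z → z :* y :- z :* x := z :* (y :- x)) refl x y z)

  *-monoʳ-≤ : ∀ {x y z} → 0# ≤ z → x ≤ y → x * z ≤ y * z
  *-monoʳ-≤ {x} {y} {z} 0≤z x≤y = ≤-by (*-nonneg 0≤z (x≤y⇒0≤y-x x≤y))
    (solve 3 (λ x y z → y :* z :- x :* z := z :* (y :- x)) refl x y z)

  *-mono-≤ : ∀ {x y z w} → 0# ≤ x → 0# ≤ w → x ≤ y → z ≤ w → x * z ≤ y * w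
  *-mono-≤ 0≤x 0≤w x≤y z≤w = Order.trans (*-monoˡ-≤ 0≤x z≤w) (*-monoʳ-≤ 0≤w x≤y)

  neg-mono-≤ : ∀ {x y} → x ≤ y → - y ≤ - x
  neg-mono-≤ {x} {y} x≤y = ≤-by (x≤y⇒0≤y-x x≤y)
    (solve 2 (λ x y → :- x :- (:- y) := y :- x) refl x y)

  neg-cancel-≤ : ∀ {x y} → - y ≤ - x → x ≤ y
  neg-cancel-≤ {x} {y} -y≤-x = ≤-by (x≤y⇒0≤y-x -y≤-x)
    (solve 2 (λ x y → y :- x := :- x :- (:- y)) refl x y)

  -- 1 = (-1)².
  0≤1 : 0# ≤ 1#
  0≤1 with Order.total 0# 1#
  ... | inj₁ 0≤1 = 0≤1
  ... | inj₂ 1≤0 = begin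
    0#                ≤⟨ *-nonneg 0≤-1 0≤-1 ⟩
    (- 1#) * (- 1#)   ≈⟨ solve 0 ((:- :1) :* (:- :1) := :1) refl ⟩
    1#                ∎
    where
    0≤-1 : 0# ≤ - 1#
    0≤-1 = ≤-by (x≤y⇒0≤y-x 1≤0) (solve 0 ((:- :1) :- :0 := :0 :- :1) refl)

  0<1 : 0# < 1#
  0<1 = 0≤1 , 0≉1

  x≤x+y : ∀ {x y} → 0# ≤ y → x ≤ x + y
  x≤x+y {x} {y} 0≤y = ≤-by 0≤y (solve 2 (λ x y → x :+ y :- x := y) refl x y)

  x-y≤x : ∀ {x y} → 0# ≤ y → x - y ≤ x
  x-y≤x {x} {y} 0≤y = ≤-by 0≤y (solve 2 (λ x y → x :- (x :- y) := y) refl x y)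

  ≤-cancelʳ-+ : ∀ {x y} z → x + z ≤ y + z → x ≤ y
  ≤-cancelʳ-+ {x} {y} z x+z≤y+z = ≤-by (x≤y⇒0≤y-x x+z≤y+z)
    (solve 3 (λ x y z → y :- x := y :+ z :- (x :+ z)) refl x y z)

  +-monoˡ-< : ∀ {x y} z → x < y → x + z < y + z
  +-monoˡ-< z x<y = ≰⇒> (λ y+z≤x+z → <⇒≱ x<y (≤-cancelʳ-+ z y+z≤x+z))

  *-pos : ∀ {x y} → 0# < x → 0# < y → 0# < x * y
  *-pos {x} {y} (0≤x , 0≉x) (0≤y , 0≉y) = *-nonneg 0≤x 0≤y , λ 0≈xy → 0≉y (begin-equality
    0#               ≈⟨ zeroʳ (x ⁻¹) ⟨
    x ⁻¹ * 0#        ≈⟨ *-congˡ 0≈xy ⟩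
    x ⁻¹ * (x * y)   ≈⟨ solve 3 (λ x y i → i :* (x :* y) := (x :* i) :* y) refl x y (x ⁻¹) ⟩
    (x * x ⁻¹) * y   ≈⟨ *-congʳ (*-inverseʳ x (λ x≈0 → 0≉x (sym x≈0))) ⟩
    1# * y           ≈⟨ *-identityˡ y ⟩
    y                ∎)

  *-monoˡ-< : ∀ {x y z} → 0# < z → x < y → z * x < z * y
  *-monoˡ-< {x} {y} {z} 0<z x<y@(x≤y , x≉y) = *-monoˡ-≤ (proj₁ 0<z) x≤y , λ zx≈zy →
    proj₂ (*-pos 0<z 0<y-x) (begin-equality
      0#             ≈⟨ -‿inverseʳ (z * x) ⟨
      z * x - z * x  ≈⟨ +-congʳ zx≈zy ⟩
      z * y - z * x  ≈⟨ solve 3 (λ x y z → z :* y :- z :* x := z :* (y :- x)) refl x y z ⟩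
      z * (y - x)    ∎)
    where
    0<y-x : 0# < y - x
    0<y-x = x≤y⇒0≤y-x x≤y , λ 0≈y-x → x≉y (begin-equality
      x            ≈⟨ +-identityʳ x ⟨
      x + 0#       ≈⟨ +-congˡ 0≈y-x ⟩
      x + (y - x)  ≈⟨ solve 2 (λ x y → x :+ (y :- x) := y) refl x y ⟩
      y            ∎)

  ≤-cancelˡ-* : ∀ {x y z} → 0# < z → z * x ≤ z * y → x ≤ y
  ≤-cancelˡ-* 0<z zx≤zy = ≮⇒≥ (λ y<x → <⇒≱ (*-monoˡ-< 0<z y<x) zx≤zy)

  x*x⁻¹≈1 : ∀ {x} → 0# < x → x * x ⁻¹ ≈ 1#
  x*x⁻¹≈1 {x} (_ , 0≉x) = *-inverseʳ x (λ x≈0 → 0≉x (sym x≈0))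

  ⁻¹-pos : ∀ {x} → 0# < x → 0# < x ⁻¹
  ⁻¹-pos {x} 0<x = ≰⇒> λ x⁻¹≤0 → <⇒≱ 0<1 (begin
    1#         ≈⟨ x*x⁻¹≈1 0<x ⟨
    x * x ⁻¹   ≤⟨ *-monoˡ-≤ (proj₁ 0<x) x⁻¹≤0 ⟩
    x * 0#     ≈⟨ zeroʳ x ⟩
    0#         ∎)

  ^-nonneg : ∀ {x} n → 0# ≤ x → 0# ≤ x ^ n
  ^-nonneg zero    0≤x = 0≤1
  ^-nonneg (suc n) 0≤x = *-nonneg 0≤x (^-nonneg n 0≤x)

  ^-pos : ∀ {x} n → 0# < x → 0# < x ^ n
  ^-pos zero    0<x = 0<1
  ^-pos (suc n) 0<x = *-pos 0<x (^-pos n 0<x)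

  ^-mono-≤ : ∀ {x y} n → 0# ≤ x → x ≤ y → x ^ n ≤ y ^ n
  ^-mono-≤ zero    0≤x x≤y = Order.refl
  ^-mono-≤ (suc n) 0≤x x≤y =
    *-mono-≤ 0≤x (^-nonneg n (Order.trans 0≤x x≤y)) x≤y (^-mono-≤ n 0≤x x≤y)

  ^-≤1 : ∀ {x} n → 0# ≤ x → x ≤ 1# → x ^ n ≤ 1#
  ^-≤1 zero    0≤x x≤1 = Order.refl
  ^-≤1 {x} (suc n) 0≤x x≤1 = begin
    x * x ^ n  ≤⟨ *-monoˡ-≤ 0≤x (^-≤1 n 0≤x x≤1) ⟩
    x * 1#     ≈⟨ *-identityʳ x ⟩
    x          ≤⟨ x≤1 ⟩
    1#         ∎

  fromℕ-nonneg : ∀ n → 0# ≤ fromℕ n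
  fromℕ-nonneg zero    = Order.refl
  fromℕ-nonneg (suc n) = +-nonneg 0≤1 (fromℕ-nonneg n)

  0<fromℕ-suc : ∀ n → 0# < fromℕ (suc n)
  0<fromℕ-suc n = ≰⇒> λ 1+n≤0 → <⇒≱ 0<1 (Order.trans (x≤x+y (fromℕ-nonneg n)) 1+n≤0)

  fromℕ-homo-+ : ∀ m n → fromℕ (m ℕ.+ n) ≈ fromℕ m + fromℕ n
  fromℕ-homo-+ = SemiringMult.×-homo-+ semiring 1#

  fromℕ-homo-* : ∀ m n → fromℕ (m ℕ.* n) ≈ fromℕ m * fromℕ n
  fromℕ-homo-* = SemiringMult.×1-homo-* semiring

  fromℕ-homo-^ : ∀ m n → fromℕ (m ℕ.^ n) ≈ fromℕ m ^ n
  fromℕ-homo-^ m zero    = +-identityʳ 1#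
  fromℕ-homo-^ m (suc n) =
    trans (fromℕ-homo-* m (m ℕ.^ n)) (*-congˡ (fromℕ-homo-^ m n))

  fromℕ-mono-≤ : ∀ {m n} → m ℕ.≤ n → fromℕ m ≤ fromℕ n
  fromℕ-mono-≤ {m} {n} m≤n = begin
    fromℕ m                     ≤⟨ x≤x+y (fromℕ-nonneg (n ℕ.∸ m)) ⟩
    fromℕ m + fromℕ (n ℕ.∸ m)   ≈⟨ fromℕ-homo-+ m (n ℕ.∸ m) ⟨
    fromℕ (m ℕ.+ (n ℕ.∸ m))     ≡⟨ ≡.cong fromℕ (ℕ.m+[n∸m]≡n m≤n) ⟩
    fromℕ n                     ∎

  1+fromℕ≤ : ∀ {m n} → m ℕ.< n → fromℕ m + 1# ≤ fromℕ n
  1+fromℕ≤ {m} m<n = Order.trans (Order.reflexive (+-comm (fromℕ m) 1#)) (fromℕ-mono-≤ m<n)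

  fromℕ-cancel-≤ : ∀ {m n} → fromℕ m < fromℕ n + 1# → m ℕ.≤ n
  fromℕ-cancel-≤ m<n+1 = ℕ.≮⇒≥ (λ n<m → <⇒≱ m<n+1 (1+fromℕ≤ n<m))

  fromℕ2 : fromℕ 2 ≈ 1# + 1#
  fromℕ2 = +-congˡ (+-identityʳ 1#)

  0<2^ : ∀ n → 0# < 2^ (+ n)
  0<2^ n = ^-pos n (0<fromℕ-suc 1)

  ^-homo-+ : ∀ x m n → x ^ (m ℕ.+ n) ≈ x ^ m * x ^ n
  ^-homo-+ = SemiringExp.^-homo-* semiring

  ^-cong : ∀ {x y} n → x ≈ y → x ^ n ≈ y ^ n
  ^-cong n x≈y = SemiringExp.^-congˡ semiring n x≈y

  -- Natural exponents keep `ε-+` free of sign cases; `2^-≈ε` links this to the negative powers in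
  -- `InBucket`.
  ε : ℕ → ℝ
  ε n = (2^ (+ n)) ⁻¹

  2^*ε : ∀ n → 2^ (+ n) * ε n ≈ 1#
  2^*ε n = x*x⁻¹≈1 (0<2^ n)

  0<ε : ∀ n → 0# < ε n
  0<ε n = ⁻¹-pos (0<2^ n)

  0≤ε : ∀ n → 0# ≤ ε n
  0≤ε n = proj₁ (0<ε n)

  ⁻¹-unique : ∀ {x y} → 0# < x → x * y ≈ 1# → y ≈ x ⁻¹
  ⁻¹-unique {x} {y} 0<x xy≈1 = begin-equality
    y               ≈⟨ *-identityˡ y ⟨
    1# * y          ≈⟨ *-congʳ (x*x⁻¹≈1 0<x) ⟨
    x * x ⁻¹ * y    ≈⟨ solve 3 (λ x y i → x :* i :* y := i :* (x :* y)) refl x y (x ⁻¹) ⟩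
    x ⁻¹ * (x * y)  ≈⟨ *-congˡ xy≈1 ⟩
    x ⁻¹ * 1#       ≈⟨ *-identityʳ _ ⟩
    x ⁻¹            ∎

  ε-zero : ε 0 ≈ 1#
  ε-zero = sym (⁻¹-unique 0<1 (*-identityʳ 1#))

  ε-+ : ∀ m n → ε (m ℕ.+ n) ≈ ε m * ε n
  ε-+ m n = sym (⁻¹-unique (0<2^ (m ℕ.+ n)) (begin-equality
    2^ (+ (m ℕ.+ n)) * (ε m * ε n)       ≈⟨ *-congʳ (^-homo-+ (fromℕ 2) m n) ⟩
    2^ (+ m) * 2^ (+ n) * (ε m * ε n)    ≈⟨ solve 4 (λ a b c d → a :* b :* (c :* d) := (a :* c) :* (b :* d)) refl
                                              (2^ (+ m)) (2^ (+ n)) (ε m) (ε n) ⟩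
    2^ (+ m) * ε m * (2^ (+ n) * ε n)    ≈⟨ *-cong (2^*ε m) (2^*ε n) ⟩
    1# * 1#                              ≈⟨ *-identityʳ 1# ⟩
    1#                                   ∎))

  ε-suc : ∀ n → ε n ≈ ε (suc n) + ε (suc n)
  ε-suc n = begin-equality
    ε n                                       ≈⟨ *-identityˡ (ε n) ⟨
    1# * ε n                                  ≈⟨ *-congʳ (2^*ε 1) ⟨
    fromℕ 2 * 1# * ε 1 * ε n                  ≈⟨ *-congʳ (*-congʳ (*-congʳ fromℕ2)) ⟩
    (1# + 1#) * 1# * ε 1 * ε n                ≈⟨ solve 2 (λ a b → :2 :* :1 :* a :* b := a :* b :+ a :* b) refl (ε 1) (ε n) ⟩
    ε 1 * ε n + ε 1 * ε n                     ≈⟨ +-cong (ε-+ 1 n) (ε-+ 1 n) ⟨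
    ε (suc n) + ε (suc n)                     ∎

  ε-anti : ∀ n → ε (suc n) ≤ ε n
  ε-anti n = Order.trans (x≤x+y (0≤ε (suc n))) (Order.reflexive (sym (ε-suc n)))

  ε≤1 : ∀ n → ε n ≤ 1#
  ε≤1 zero    = Order.reflexive ε-zero
  ε≤1 (suc n) = Order.trans (ε-anti n) (ε≤1 n)

  2^-≈ε : ∀ n → 2^ (ℤ.- + n) ≈ ε n
  2^-≈ε zero    = sym ε-zero
  2^-≈ε (suc n) = refl

  private
    -- The difference of the two sides is (xⁱ - yⁱ)(xʲ - yʲ)(xᵐ - yᵐ) + xᵐyᵐ(xᵈ - yᵈ), and every
    -- factor is nonnegative.
    paired-powers : ∀ {x y} m d i j → 0# ≤ y → y ≤ x → i ℕ.+ j ≡ m ℕ.+ d →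
      (x ^ i * y ^ j + x ^ j * y ^ i) * (x ^ m - y ^ m) ≤
      x ^ (m ℕ.+ d) * x ^ m - y ^ (m ℕ.+ d) * y ^ m
    paired-powers {x} {y} m d i j 0≤y y≤x i+j≡m+d =
      ≤-by (+-nonneg (*-nonneg (*-nonneg (diff i) (diff j)) (diff m))
                     (*-nonneg (*-nonneg (^-nonneg m 0≤x) (^-nonneg m 0≤y)) (diff d)))
      (begin-equality
        X * c - Y * c′ - (a * b′ + b * a′) * (c - c′)
          ≈⟨ solve 8 (λ X Y a b c a′ b′ c′ →
               X :* c :- Y :* c′ :- (a :* b′ :+ b :* a′) :* (c :- c′) :=
               (X :+ Y :- (a :* b′ :+ b :* a′)) :* (c :- c′) :+ (X :* c′ :- Y :* c))
               refl X Y a b c a′ b′ c′ ⟩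
        (X + Y - (a * b′ + b * a′)) * (c - c′) + (X * c′ - Y * c)
          ≈⟨ +-cong (*-congʳ (+-congʳ (+-cong (split x) (split y))))
                    (+-cong (*-congʳ (^-homo-+ x m d)) (-‿cong (*-congʳ (^-homo-+ y m d)))) ⟩
        (a * b + a′ * b′ - (a * b′ + b * a′)) * (c - c′) + (c * e * c′ - c′ * e′ * c)
          ≈⟨ solve 8 (λ a b c a′ b′ c′ e e′ →
               (a :* b :+ a′ :* b′ :- (a :* b′ :+ b :* a′)) :* (c :- c′) :+ (c :* e :* c′ :- c′ :* e′ :* c) :=
               (a :- a′) :* (b :- b′) :* (c :- c′) :+ c :* c′ :* (e :- e′))
               refl a b c a′ b′ c′ e e′ ⟩
        (a - a′) * (b - b′) * (c - c′) + c * c′ * (e - e′) ∎)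
      where
      a = x ^ i
      b = x ^ j
      c = x ^ m
      e = x ^ d
      a′ = y ^ i
      b′ = y ^ j
      c′ = y ^ m
      e′ = y ^ d
      X = x ^ (m ℕ.+ d)
      Y = y ^ (m ℕ.+ d)
      0≤x = Order.trans 0≤y y≤x
      diff : ∀ k → 0# ≤ x ^ k - y ^ k
      diff k = x≤y⇒0≤y-x (^-mono-≤ k 0≤y y≤x)
      split : ∀ z → z ^ (m ℕ.+ d) ≈ z ^ i * z ^ j
      split z = trans (reflexive (≡.cong (z ^_) (≡.sym i+j≡m+d))) (^-homo-+ z i j)

    -- With N = m + d + 1 = t + s, the terms xᵗyˢ - yᴺ and xᴺ - xˢyᵗ are x - y times the first t
    -- terms of Σ xˡyᴺ⁻¹⁻ˡ and of Σ xᴺ⁻¹⁻ˡyˡ. Each step of the induction splits off one symmetric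
    -- pair for `paired-powers`.
    paired-power-sum : ∀ {x y} m d t s → 0# ≤ y → y ≤ x → t ℕ.+ s ≡ suc (m ℕ.+ d) →
      (x ^ t * y ^ s - y ^ suc (m ℕ.+ d) + (x ^ suc (m ℕ.+ d) - x ^ s * y ^ t)) * (x ^ m - y ^ m) ≤
      fromℕ t * ((x - y) * (x ^ (m ℕ.+ d) * x ^ m - y ^ (m ℕ.+ d) * y ^ m))
    paired-power-sum {x} {y} m d zero s 0≤y y≤x ≡.refl =
      Order.reflexive (solve 4 (λ X Y C D → (:1 :* Y :- Y :+ (X :- X :* :1)) :* C := :0 :* D)
        refl (x ^ s) (y ^ s) _ _)
    paired-power-sum {x} {y} m d (suc t) s 0≤y y≤x t+s≡ = begin
      (x * x ^ t * y ^ s - Y + (X - x ^ s * (y * y ^ t))) * C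
        ≈⟨ solve 9 (λ x y a b a′ b′ X Y C →
             (x :* a :* b′ :- Y :+ (X :- b :* (y :* a′))) :* C :=
             (a :* (y :* b′) :- Y :+ (X :- x :* b :* a′)) :* C :+ (x :- y) :* ((a :* b′ :+ b :* a′) :* C))
             refl x y (x ^ t) (x ^ s) (y ^ t) (y ^ s) X Y C ⟩
      (x ^ t * y ^ suc s - Y + (X - x ^ suc s * y ^ t)) * C +
      (x - y) * ((x ^ t * y ^ s + x ^ s * y ^ t) * C)
        ≤⟨ +-mono-≤ (paired-power-sum m d t (suc s) 0≤y y≤x (≡.trans (ℕ.+-suc t s) t+s≡))
                    (*-monoˡ-≤ (x≤y⇒0≤y-x y≤x) (paired-powers m d t s 0≤y y≤x (ℕ.suc-injective t+s≡))) ⟩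
      fromℕ t * ((x - y) * D) + (x - y) * D
        ≈⟨ solve 2 (λ t z → t :* z :+ z := (:1 :+ t) :* z) refl (fromℕ t) ((x - y) * D) ⟩
      fromℕ (suc t) * ((x - y) * D) ∎
      where
      X = x ^ suc (m ℕ.+ d)
      Y = y ^ suc (m ℕ.+ d)
      C = x ^ m - y ^ m
      D = x ^ (m ℕ.+ d) * x ^ m - y ^ (m ℕ.+ d) * y ^ m

  -- At t = N = m + d + 1 and s = 0 both partial sums of `paired-power-sum` become xᴺ - yᴺ, hence
  -- the factor 2. The doubling is essential: a single term xⁱyʲ(xᵐ - yᵐ) can exceed half of the
  -- bound that holds for a symmetric pair.
  power-differences : ∀ {x y} m d → 0# ≤ y → y ≤ x →
    (1# + 1#) * ((x ^ suc (m ℕ.+ d) - y ^ suc (m ℕ.+ d)) * (x ^ m - y ^ m)) ≤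
    fromℕ (suc (m ℕ.+ d)) * ((x - y) * (x ^ (m ℕ.+ d ℕ.+ m) - y ^ (m ℕ.+ d ℕ.+ m)))
  power-differences {x} {y} m d 0≤y y≤x = begin
    (1# + 1#) * ((X - Y) * C)
      ≈⟨ solve 3 (λ X Y C → :2 :* ((X :- Y) :* C) := (X :* :1 :- Y :+ (X :- :1 :* Y)) :* C) refl X Y C ⟩
    (X * 1# - Y + (X - 1# * Y)) * C
      ≤⟨ paired-power-sum m d (suc n) 0 0≤y y≤x (ℕ.+-identityʳ (suc n)) ⟩
    fromℕ (suc n) * ((x - y) * (x ^ n * x ^ m - y ^ n * y ^ m))
      ≈⟨ *-congˡ (*-congˡ (+-cong (^-homo-+ x n m) (-‿cong (^-homo-+ y n m)))) ⟨
    fromℕ (suc n) * ((x - y) * (x ^ (n ℕ.+ m) - y ^ (n ℕ.+ m))) ∎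
    where
    n = m ℕ.+ d
    X = x ^ suc n
    Y = y ^ suc n
    C = x ^ m - y ^ m

  -- Convexity: (n + 1) yⁿ is the slope of the power at y. The induction multiplies the previous
  -- estimate by y and then enlarges that y to x.
  tangent-below : ∀ {x y} n → 0# ≤ y → y ≤ x →
    fromℕ (suc n) * ((x - y) * y ^ n) ≤ x ^ suc n - y ^ suc n
  tangent-below {x} {y} zero 0≤y y≤x = Order.reflexive
    (solve 2 (λ x y → (:1 :+ :0) :* ((x :- y) :* :1) := x :* :1 :- y :* :1) refl x y)
  tangent-below {x} {y} (suc n) 0≤y y≤x = begin
    fromℕ (suc (suc n)) * ((x - y) * (y * y ^ n))
      ≈⟨ solve 4 (λ N x y b → (:1 :+ N) :* ((x :- y) :* (y :* b)) :=
           y :* (N :* ((x :- y) :* b)) :+ (x :- y) :* (y :* b)) refl (fromℕ (suc n)) x y (y ^ n) ⟩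
    y * (fromℕ (suc n) * ((x - y) * y ^ n)) + (x - y) * (y * y ^ n)
      ≤⟨ +-monoˡ-≤ _ (*-monoˡ-≤ 0≤y (tangent-below n 0≤y y≤x)) ⟩
    y * (X - Y) + (x - y) * Y
      ≤⟨ +-monoˡ-≤ _ (*-monoʳ-≤ (x≤y⇒0≤y-x (^-mono-≤ (suc n) 0≤y y≤x)) y≤x) ⟩
    x * (X - Y) + (x - y) * Y
      ≈⟨ solve 4 (λ x y X Y → x :* (X :- Y) :+ (x :- y) :* Y := x :* X :- y :* Y) refl x y X Y ⟩
    x * X - y * Y ∎
    where
    X = x ^ suc n
    Y = y ^ suc n

-- Finite unions, and σ-algebras of decidable sets.

≤1∧≢1⇒≡0 : ∀ {n} → n ℕ.≤ 1 → n ≢ 1 → n ≡ 0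
≤1∧≢1⇒≡0 n≤1 n≢1 = ℕ.n<1⇒n≡0 (ℕ.≤∧≢⇒< n≤1 n≢1)

⋃< : {A : Set} → ℕ → (ℕ → Pred A 0ℓ) → Pred A 0ℓ
⋃< n E ω = ∃ λ k → k ℕ.< n ∧ E k ω

⋃<-suc : {A : Set} (n : ℕ) (E : ℕ → Pred A 0ℓ) → ⋃< n E ∪ E n ≐ ⋃< (suc n) E
⋃<-suc n E = [ (λ (k , k<n , e) → k , ℕ.m<n⇒m<1+n k<n , e) , (λ e → n , ℕ.≤-refl , e) ] , split
  where
  split : ⋃< (suc n) E ⊆ ⋃< n E ∪ E n
  split (k , k<1+n , e) with ℕ.m<1+n⇒m<n∨m≡n k<1+n
  ... | inj₁ k<n    = inj₁ (k , k<n , e)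
  ... | inj₂ ≡.refl = inj₂ e

-- The axioms provide countable unions only, so a binary union is padded with `∅`.
pair : {A : Set} → Pred A 0ℓ → Pred A 0ℓ → ℕ → Pred A 0ℓ
pair E F zero          = E
pair E F (suc zero)    = F
pair E F (suc (suc _)) = ∅

⋃-pair : {A : Set} (E F : Pred A 0ℓ) → ⋃ ℕ (pair E F) ≐ E ∪ F
⋃-pair E F = split , [ (0 ,_) , (1 ,_) ]
  where
  split : ⋃ ℕ (pair E F) ⊆ E ∪ F
  split (zero        , e) = inj₁ e
  split (suc zero    , f) = inj₂ f

-- The σ-algebra axioms close the events under intersection only classically,
-- so events are carried together with a decision procedure.
module DecidableMeasurable {A : Set} (M : Pred A 0ℓ → Set₁)
  (M-resp : ∀ {E F} → E ≐ F → M E → M F)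
  (M-U : M U)
  (M-∁ : ∀ {E} → M E → M (∁ E))
  (M-⋃ : (E : ℕ → Pred A 0ℓ) → (∀ k → M (E k)) → M (⋃ ℕ E))
  where

  record Measurable (E : Pred A 0ℓ) : Set₁ where
    constructor _,_
    field
      measurable : M E
      decide     : Decidable E

  open Measurable public

  M-∅ : M ∅
  M-∅ = M-resp ((λ ¬tt → ¬tt _) , λ ()) (M-∁ M-U)

  M-∪ : ∀ {E F} → M E → M F → M (E ∪ F)
  M-∪ {E} {F} e f = M-resp (⋃-pair E F) (M-⋃ (pair E F) λ where
    zero          → e
    (suc zero)    → f
    (suc (suc _)) → M-∅)

  resp : ∀ {E F} → E ≐ F → Measurable E → Measurable F
  resp E≐F@(E⊆F , F⊆E) (e , e?) = M-resp E≐F e , λ ω → Dec.map′ E⊆F F⊆E (e? ω)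

  meas-U : Measurable U
  meas-U = M-U , λ _ → yes _

  meas-∅ : Measurable ∅
  meas-∅ = M-∅ , λ _ → no λ ()

  meas-∁ : ∀ {E} → Measurable E → Measurable (∁ E)
  meas-∁ (e , e?) = M-∁ e , λ ω → ¬? (e? ω)

  meas-∪ : ∀ {E F} → Measurable E → Measurable F → Measurable (E ∪ F)
  meas-∪ (e , e?) (f , f?) = M-∪ e f , λ ω → e? ω ⊎-dec f? ω

  meas-∩ : ∀ {E F} → Measurable E → Measurable F → Measurable (E ∩ F)
  meas-∩ {E} {F} (e , e?) (f , f?) =
    M-resp deMorgan (M-∁ (M-∪ (M-∁ e) (M-∁ f))) , λ ω → e? ω ×-dec f? ω
    where
    deMorgan : ∁ (∁ E ∪ ∁ F) ≐ E ∩ F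
    deMorgan = (λ {ω} ¬¬ → decidable-stable (e? ω) (¬¬ ∘ inj₁) , decidable-stable (f? ω) (¬¬ ∘ inj₂))
             , (λ (e , f) → [ (λ ¬e → ¬e e) , (λ ¬f → ¬f f) ])

  meas-⇒ : ∀ {E F} → Measurable E → Measurable F → Measurable (λ ω → E ω → F ω)
  meas-⇒ {E} {F} e f = resp (to , from) (meas-∪ (meas-∁ e) f)
    where
    to : (∁ E ∪ F) ⊆ (λ ω → E ω → F ω)
    to (inj₁ ¬e) e = contradiction e ¬e
    to (inj₂ f)  _ = f
    from : (λ ω → E ω → F ω) ⊆ (∁ E ∪ F)
    from {ω} e⇒f with decide e ω
    ... | yes e = inj₂ (e⇒f e)
    ... | no ¬e = inj₁ ¬e

  meas-⋃< : ∀ n {E} → (∀ k → Measurable (E k)) → Measurable (⋃< n E)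
  meas-⋃< zero    e = resp ((λ ()) , λ ()) meas-∅
  meas-⋃< (suc n) {E} e = resp (⋃<-suc n E) (meas-∪ (meas-⋃< n e) (e n))

  meas-All : {I : Set} {E : I → Pred A 0ℓ} → (∀ i → Measurable (E i)) →
             ∀ is → Measurable (λ ω → All (λ i → E i ω) is)
  meas-All e []       = resp ((λ _ → []) , λ _ → _) meas-U
  meas-All e (i ∷ is) = resp (uncurry _∷_ , All.uncons) (meas-∩ (e i) (meas-All e is))

  meas-Any : {I : Set} {E : I → Pred A 0ℓ} → (∀ i → Measurable (E i)) →
             ∀ is → Measurable (λ ω → Any (λ i → E i ω) is)
  meas-Any e []       = resp ((λ ()) , λ ()) meas-∅
  meas-Any e (i ∷ is) = resp ([ here , there ] , Any.toSum) (meas-∪ (e i) (meas-Any e is))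

  meas-ℕ-< : {X : A → ℕ} → (∀ k → Measurable (λ ω → X ω ≡ k)) →
             ∀ n → Measurable (λ ω → X ω ℕ.< n)
  meas-ℕ-< X n = resp ((λ { (k , k<n , ≡.refl) → k<n }) , λ X<n → _ , X<n , ≡.refl) (meas-⋃< n X)

  meas-ℕ-+ : {X Y : A → ℕ} → (∀ ω → X ω ℕ.≤ 1) →
             Measurable (λ ω → X ω ≡ 1) → (∀ k → Measurable (λ ω → Y ω ≡ k)) →
             ∀ k → Measurable (λ ω → X ω ℕ.+ Y ω ≡ k)
  meas-ℕ-+ {X} {Y} X≤1 mX mY k = resp (to , from)
    (meas-∪ (meas-∩ mX (Y+1 k)) (meas-∩ (meas-∁ mX) (mY k)))
    where
    Y+1 : ∀ k → Measurable (λ ω → suc (Y ω) ≡ k)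
    Y+1 zero    = resp ((λ ()) , λ ()) meas-∅
    Y+1 (suc k) = resp (≡.cong suc , ℕ.suc-injective) (mY k)
    Cases = ((λ ω → X ω ≡ 1) ∩ (λ ω → suc (Y ω) ≡ k)) ∪ (∁ (λ ω → X ω ≡ 1) ∩ (λ ω → Y ω ≡ k))
    to : Cases ⊆ (λ ω → X ω ℕ.+ Y ω ≡ k)
    to {ω} (inj₁ (X≡1 , eq)) = ≡.trans (≡.cong (ℕ._+ Y ω) X≡1) eq
    to {ω} (inj₂ (X≢1 , eq)) = ≡.trans (≡.cong (ℕ._+ Y ω) (≤1∧≢1⇒≡0 (X≤1 ω) X≢1)) eq
    from : (λ ω → X ω ℕ.+ Y ω ≡ k) ⊆ Cases
    from {ω} eq with decide mX ω
    ... | yes x = inj₁ (x , ≡.trans (≡.cong (ℕ._+ Y ω) (≡.sym x)) eq)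
    ... | no ¬x = inj₂ (¬x , ≡.trans (≡.cong (ℕ._+ Y ω) (≡.sym (≤1∧≢1⇒≡0 (X≤1 ω) ¬x))) eq)

-- Finite additivity, telescoping union bounds, and means of counting variables.

module ProbabilityProperties (ℛ : Reals) (𝒫 : Probability.ProbabilitySpace ℛ) where

  open Reals ℛ
  open OrderedFieldProperties orderedField
  open Probability.ProbabilitySpace 𝒫
  open DecidableMeasurable Event Event-resp Event-U Event-∁ Event-⋃ public
  open CommutativeMonoidSum +-commutativeMonoid using (sum-cong-≋; ∑-distrib-+)
  open PartialOrderReasoning Order.poset

  sum-last : ∀ n (f : ℕ → ℝ) → sum {suc n} (f ∘ toℕ) ≈ sum {n} (f ∘ toℕ) + f n
  sum-last zero    f = trans (+-identityʳ (f 0)) (sym (+-identityˡ (f 0)))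
  sum-last (suc n) f = trans (+-congˡ (sum-last n (f ∘ suc))) (sym (+-assoc _ _ _))

  sum-bound : ∀ n (f : ℕ → ℝ) {c} → (∀ k → k ℕ.< n → f k ≤ c) → sum {n} (f ∘ toℕ) ≤ fromℕ n * c
  sum-bound zero    f {c} f≤c = Order.reflexive (sym (zeroˡ c))
  sum-bound (suc n) f {c} f≤c = begin
    f 0 + sum {n} (f ∘ suc ∘ toℕ)
      ≤⟨ +-mono-≤ (f≤c 0 (s≤s z≤n)) (sum-bound n (f ∘ suc) (λ k k<n → f≤c (suc k) (s≤s k<n))) ⟩
    c + fromℕ n * c      ≈⟨ solve 2 (λ n c → c :+ n :* c := (:1 :+ n) :* c) refl (fromℕ n) c ⟩
    fromℕ (suc n) * c    ∎

  P-cong : ∀ {E F} → Measurable E → E ≐ F → ℙ E ≈ ℙ F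
  P-cong e E≐F = ℙ-cong (measurable e) (measurable (resp E≐F e)) E≐F

  -- Additivity is given as a least upper bound of partial sums. For the padded pair the partial sum
  -- of length 2 equals `ℙ E + ℙ F` and no other exceeds it, so antisymmetry yields the value.
  P-∪ : ∀ {E F} → Measurable E → Measurable F → E Unary.⊥ F → ℙ (E ∪ F) ≈ ℙ E + ℙ F
  P-∪ {E} {F} e f E⊥F = begin-equality
    ℙ (E ∪ F)           ≈⟨ ℙ-cong (M-∪ (measurable e) (measurable f)) (Event-⋃ (pair E F) events)
                             (proj₂ (⋃-pair E F) , proj₁ (⋃-pair E F)) ⟩
    ℙ (⋃ ℕ (pair E F))  ≈⟨ Order.antisym (proj₂ lub _ upper) (proj₁ lub _ (2 , +-congˡ (sym (+-identityʳ (ℙ F))))) ⟩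
    ℙ E + ℙ F           ∎
    where
    events : ∀ k → Event (pair E F k)
    events zero          = measurable e
    events (suc zero)    = measurable f
    events (suc (suc _)) = M-∅

    disjoint : ∀ j k → j ≢ k → pair E F j Unary.⊥ pair E F k
    disjoint zero          zero          j≢k = contradiction ≡.refl j≢k
    disjoint zero          (suc zero)    _   = E⊥F
    disjoint zero          (suc (suc _)) _   = proj₂
    disjoint (suc zero)    zero          _   (f , e) = E⊥F (e , f)
    disjoint (suc zero)    (suc zero)    j≢k = contradiction ≡.refl j≢k
    disjoint (suc zero)    (suc (suc _)) _   = proj₂
    disjoint (suc (suc _)) _             _   = proj₁

    lub = ℙ-⋃ (pair E F) events disjoint

    tail≤0 : ∀ n → sum {n} (λ _ → ℙ ∅) ≤ 0#
    tail≤0 n = begin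
      sum {n} (λ _ → ℙ ∅)   ≤⟨ sum-bound n (λ _ → ℙ ∅) (λ _ _ → Order.reflexive ℙ-∅) ⟩
      fromℕ n * 0#          ≈⟨ zeroʳ (fromℕ n) ⟩
      0#                    ∎

    upper : IsUpperBound (λ y → ∃ λ n → y ≈ sum {n} (λ k → ℙ (pair E F (toℕ k)))) (ℙ E + ℙ F)
    upper y (zero , y≈) = Order.trans (Order.reflexive y≈)
      (+-nonneg (ℙ-nonneg (measurable e)) (ℙ-nonneg (measurable f)))
    upper y (suc zero , y≈) = Order.trans (Order.reflexive y≈)
      (+-mono-≤ Order.refl (ℙ-nonneg (measurable f)))
    upper y (suc (suc n) , y≈) = begin
      y                                         ≈⟨ y≈ ⟩
      ℙ E + (ℙ F + sum {n} (λ _ → ℙ ∅))         ≤⟨ +-mono-≤ Order.refl (+-mono-≤ Order.refl (tail≤0 n)) ⟩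
      ℙ E + (ℙ F + 0#)                          ≈⟨ +-congˡ (+-identityʳ (ℙ F)) ⟩
      ℙ E + ℙ F                                 ∎

  P-split : ∀ {E F} → Measurable E → Measurable F → ℙ E ≈ ℙ (E ∩ F) + ℙ (E ∩ ∁ F)
  P-split {E} {F} e f = trans (P-cong e (cases , [ proj₁ , proj₁ ]))
    (P-∪ (meas-∩ e f) (meas-∩ e (meas-∁ f)) (λ ((_ , f) , (_ , ¬f)) → ¬f f))
    where
    cases : E ⊆ (E ∩ F) ∪ (E ∩ ∁ F)
    cases {ω} e with decide f ω
    ... | yes f = inj₁ (e , f)
    ... | no ¬f = inj₂ (e , ¬f)

  P-mono : ∀ {E F} → Measurable E → Measurable F → E ⊆ F → ℙ E ≤ ℙ F
  P-mono {E} {F} e f E⊆F = begin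
    ℙ E                         ≤⟨ x≤x+y (ℙ-nonneg (measurable (meas-∩ f (meas-∁ e)))) ⟩
    ℙ E + ℙ (F ∩ ∁ E)           ≈⟨ +-congʳ (P-cong e ((λ e → E⊆F e , e) , proj₂)) ⟩
    ℙ (F ∩ E) + ℙ (F ∩ ∁ E)     ≈⟨ P-split f e ⟨
    ℙ F                         ∎

  P-∪-≤ : ∀ {E F} → Measurable E → Measurable F → ℙ (E ∪ F) ≤ ℙ E + ℙ F
  P-∪-≤ {E} {F} e f = begin
    ℙ (E ∪ F)                             ≈⟨ P-split (meas-∪ e f) e ⟩
    ℙ ((E ∪ F) ∩ E) + ℙ ((E ∪ F) ∩ ∁ E)   ≤⟨ +-mono-≤ (P-mono (meas-∩ (meas-∪ e f) e) e proj₂)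
                                               (P-mono (meas-∩ (meas-∪ e f) (meas-∁ e)) f λ where
                                                 (inj₁ e , ¬e) → contradiction e ¬e
                                                 (inj₂ f , _)  → f) ⟩
    ℙ E + ℙ F                             ∎

  -- A union bound whose terms are increments of `g`, so that no sum has to be evaluated. It is
  -- applied over the cells of a band and again over the values of ρ.
  P-⋃<-telescope : ∀ n {E} (g : ℕ → ℝ) → (∀ k → Measurable (E k)) →
    (∀ k → k ℕ.< n → ℙ (E k) ≤ g (suc k) - g k) → ℙ (⋃< n E) ≤ g n - g 0
  P-⋃<-telescope zero {E} g e ≤Δg = begin
    ℙ (⋃< 0 E)  ≈⟨ P-cong (meas-⋃< 0 e) ((λ ()) , λ ()) ⟩
    ℙ ∅         ≈⟨ ℙ-∅ ⟩
    0#          ≈⟨ -‿inverseʳ (g 0) ⟨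
    g 0 - g 0   ∎
  P-⋃<-telescope (suc n) {E} g e ≤Δg = begin
    ℙ (⋃< (suc n) E)                     ≈⟨ P-cong (meas-∪ (meas-⋃< n e) (e n)) (⋃<-suc n E) ⟨
    ℙ (⋃< n E ∪ E n)                     ≤⟨ P-∪-≤ (meas-⋃< n e) (e n) ⟩
    ℙ (⋃< n E) + ℙ (E n)                 ≤⟨ +-mono-≤ (P-⋃<-telescope n g e (λ k k<n → ≤Δg k (ℕ.m<n⇒m<1+n k<n)))
                                              (≤Δg n ℕ.≤-refl) ⟩
    (g n - g 0) + (g (suc n) - g n)      ≈⟨ solve 3 (λ a b c → (a :- b) :+ (c :- a) := c :- b) refl (g n) (g 0) (g (suc n)) ⟩
    g (suc n) - g 0                      ∎

  -- Inclusion-exclusion reduces the product of two differences to intersections of one event from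
  -- each pair, which are the probabilities that independence provides.
  P-differences : ∀ {E F E′ F′} →
    Measurable E → Measurable F → Measurable E′ → Measurable F′ → F ⊆ E → F′ ⊆ E′ →
    ℙ ((E ∩ ∁ F) ∩ (E′ ∩ ∁ F′)) ≈ (ℙ (E ∩ E′) - ℙ (F ∩ E′)) - (ℙ (E ∩ F′) - ℙ (F ∩ F′))
  P-differences {E} {F} {E′} {F′} e f e′ f′ F⊆E F′⊆E′ = begin-equality
    ℙ ((E ∩ ∁ F) ∩ (E′ ∩ ∁ F′))
      ≈⟨ P-cong (meas-∩ (meas-∩ e (meas-∁ f)) (meas-∩ e′ (meas-∁ f′)))
           ((λ ((e , ¬f) , (e′ , ¬f′)) → ((e , e′) , ¬f) , ¬f′)
           , (λ (((e , e′) , ¬f) , ¬f′) → (e , ¬f) , (e′ , ¬f′))) ⟩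
    ℙ (D ∩ ∁ F′)
      ≈⟨ minus (P-split d f′) ⟩
    ℙ D - ℙ (D ∩ F′)
      ≈⟨ +-congˡ (-‿cong (P-cong (meas-∩ d f′)
           ((λ (((e , _) , ¬f) , f′) → (e , f′) , ¬f)
           , (λ ((e , f′) , ¬f) → ((e , F′⊆E′ f′) , ¬f) , f′)))) ⟩
    ℙ D - ℙ ((E ∩ F′) ∩ ∁ F)
      ≈⟨ +-cong (minus (P-split (meas-∩ e e′) f)) (-‿cong (minus (P-split (meas-∩ e f′) f))) ⟩
    (ℙ (E ∩ E′) - ℙ ((E ∩ E′) ∩ F)) - (ℙ (E ∩ F′) - ℙ ((E ∩ F′) ∩ F))
      ≈⟨ +-cong (+-congˡ (-‿cong (P-cong (meas-∩ (meas-∩ e e′) f) absorb)))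
           (-‿cong (+-congˡ (-‿cong (P-cong (meas-∩ (meas-∩ e f′) f) absorb)))) ⟩
    (ℙ (E ∩ E′) - ℙ (F ∩ E′)) - (ℙ (E ∩ F′) - ℙ (F ∩ F′)) ∎
    where
    D = (E ∩ E′) ∩ ∁ F
    d = meas-∩ (meas-∩ e e′) (meas-∁ f)
    minus : ∀ {x y z} → x ≈ y + z → z ≈ x - y
    minus {x} {y} {z} x≈y+z = begin-equality
      z          ≈⟨ solve 2 (λ y z → z := y :+ z :- y) refl y z ⟩
      y + z - y  ≈⟨ +-congʳ x≈y+z ⟨
      x - y      ∎
    absorb : ∀ {G} → (E ∩ G) ∩ F ≐ F ∩ G
    absorb = (λ ((_ , g) , f) → f , g) , (λ (f , g) → (F⊆E f , g) , f)

  -- This is `𝔼` without its proof argument, on which the value does not depend, so the bound `N`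
  -- can vary freely in an induction.
  mean : ℕ → (Ω → ℕ) → ℝ
  mean N X = sum {suc N} (λ k → fromℕ (toℕ k) * ℙ (λ ω → X ω ≡ toℕ k))

  P-partition : ∀ n {E} {X : Ω → ℕ} → Measurable E → (∀ k → Measurable (λ ω → X ω ≡ k)) →
    sum {n} (λ k → ℙ (E ∩ (λ ω → X ω ≡ toℕ k))) ≈ ℙ (E ∩ (λ ω → X ω ℕ.< n))
  P-partition zero {E} {X} e x = begin-equality
    0#                          ≈⟨ ℙ-∅ ⟨
    ℙ ∅                         ≈⟨ P-cong meas-∅ ((λ ()) , λ { (_ , ()) }) ⟩
    ℙ (E ∩ (λ ω → X ω ℕ.< 0))   ∎
  P-partition (suc n) {E} {X} e x = begin-equality
    sum {suc n} (λ k → ℙ (E ∩ (λ ω → X ω ≡ toℕ k)))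
      ≈⟨ sum-last n (λ k → ℙ (E ∩ (λ ω → X ω ≡ k))) ⟩
    sum {n} (λ k → ℙ (E ∩ (λ ω → X ω ≡ toℕ k))) + ℙ (E ∩ (λ ω → X ω ≡ n))
      ≈⟨ +-congʳ (P-partition n e x) ⟩
    ℙ (E ∩ (λ ω → X ω ℕ.< n)) + ℙ (E ∩ (λ ω → X ω ≡ n))
      ≈⟨ P-∪ (meas-∩ e (meas-ℕ-< x n)) (meas-∩ e (x n))
           (λ ((_ , X<n) , (_ , X≡n)) → ℕ.<⇒≢ X<n X≡n) ⟨
    ℙ ((E ∩ (λ ω → X ω ℕ.< n)) ∪ (E ∩ (λ ω → X ω ≡ n)))
      ≈⟨ P-cong (meas-∪ (meas-∩ e (meas-ℕ-< x n)) (meas-∩ e (x n)))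
           ( [ (λ (e , X<n) → e , ℕ.m<n⇒m<1+n X<n) , (λ (e , X≡n) → e , ℕ.≤-reflexive (≡.cong suc X≡n)) ]
           , (λ (e , X<1+n) → [ (λ X<n → inj₁ (e , X<n)) , (λ X≡n → inj₂ (e , X≡n)) ] (ℕ.m<1+n⇒m<n∨m≡n X<1+n))) ⟩
    ℙ (E ∩ (λ ω → X ω ℕ.< suc n)) ∎

  -- Splitting {Z + X = k + 1} by the value of Z gives a k + b (k + 1), with `a` for Z = 1 and `b`
  -- for Z = 0. Then Σ (k + 1) a k + Σ k b k = Σ a k + Σ k (a k + b k), and the last sum is the mean
  -- of X.
  mean-+ : ∀ N {Z X : Ω → ℕ} → (∀ ω → Z ω ℕ.≤ 1) → (∀ ω → X ω ℕ.≤ N) →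
    Measurable (λ ω → Z ω ≡ 1) → (∀ k → Measurable (λ ω → X ω ≡ k)) →
    mean (suc N) (λ ω → Z ω ℕ.+ X ω) ≈ ℙ (λ ω → Z ω ≡ 1) + mean N X
  mean-+ N {Z} {X} Z≤1 X≤N z x = begin-equality
    0# * ℙ (λ ω → Z ω ℕ.+ X ω ≡ 0) + sum {suc N} (λ k → fromℕ (suc (toℕ k)) * ℙ (λ ω → Z ω ℕ.+ X ω ≡ suc (toℕ k)))
      ≈⟨ +-cong (trans (zeroˡ _) (sym (zeroˡ (b 0))))
           (sum-cong-≋ {suc N} (λ k → trans (*-congˡ {fromℕ (suc (toℕ k))} (shift (toℕ k))) (distribˡ _ _ _))) ⟩
    0# * b 0 + sum {suc N} (λ k → fromℕ (suc (toℕ k)) * a (toℕ k) + fromℕ (suc (toℕ k)) * b (suc (toℕ k)))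
      ≈⟨ +-congˡ (∑-distrib-+ {suc N} (λ k → fromℕ (suc (toℕ k)) * a (toℕ k)) (λ k → fromℕ (suc (toℕ k)) * b (suc (toℕ k)))) ⟩
    0# * b 0 + (A + B)
      ≈⟨ solve 3 (λ x y z → x :+ (y :+ z) := y :+ (x :+ z)) refl (0# * b 0) A B ⟩
    A + sum {suc (suc N)} (λ k → fromℕ (toℕ k) * b (toℕ k))
      ≈⟨ +-congˡ (sum-last (suc N) (λ k → fromℕ k * b k)) ⟩
    A + (sum {suc N} (λ k → fromℕ (toℕ k) * b (toℕ k)) + fromℕ (suc N) * b (suc N))
      -- The shifted sum reaches index N + 1, where the bound on X makes the term vanish.
      ≈⟨ +-congˡ (trans (+-congˡ (trans (*-congˡ b[1+N]≈0) (zeroʳ _))) (+-identityʳ _)) ⟩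
    A + sum {suc N} (λ k → fromℕ (toℕ k) * b (toℕ k))
      ≈⟨ ∑-distrib-+ {suc N} (λ k → fromℕ (suc (toℕ k)) * a (toℕ k)) (λ k → fromℕ (toℕ k) * b (toℕ k)) ⟨
    sum {suc N} (λ k → fromℕ (suc (toℕ k)) * a (toℕ k) + fromℕ (toℕ k) * b (toℕ k))
      ≈⟨ sum-cong-≋ {suc N} (λ k → trans (solve 3 (λ k a b → (:1 :+ k) :* a :+ k :* b := a :+ k :* (a :+ b)) refl
           (fromℕ (toℕ k)) (a (toℕ k)) (b (toℕ k))) (+-congˡ (*-congˡ (join (toℕ k))))) ⟩
    sum {suc N} (λ k → a (toℕ k) + fromℕ (toℕ k) * ℙ (λ ω → X ω ≡ toℕ k))
      ≈⟨ ∑-distrib-+ {suc N} (λ k → a (toℕ k)) (λ k → fromℕ (toℕ k) * ℙ (λ ω → X ω ≡ toℕ k)) ⟩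
    sum {suc N} (λ k → a (toℕ k)) + mean N X
      ≈⟨ +-congʳ (trans (P-partition (suc N) z x) (P-cong (meas-∩ z (meas-ℕ-< x (suc N)))
           (proj₁ , λ {ω} z → z , s≤s (X≤N ω)))) ⟩
    ℙ (λ ω → Z ω ≡ 1) + mean N X ∎
    where
    a b : ℕ → ℝ
    a k = ℙ ((λ ω → Z ω ≡ 1) ∩ (λ ω → X ω ≡ k))
    b k = ℙ ((λ ω → X ω ≡ k) ∩ ∁ (λ ω → Z ω ≡ 1))
    A = sum {suc N} (λ k → fromℕ (suc (toℕ k)) * a (toℕ k))
    B = sum {suc N} (λ k → fromℕ (suc (toℕ k)) * b (suc (toℕ k)))
    join : ∀ k → a k + b k ≈ ℙ (λ ω → X ω ≡ k)
    join k = sym (trans (P-split (x k) z) (+-congʳ (P-cong (meas-∩ (x k) z) ((λ (x , z) → z , x) , λ (z , x) → x , z))))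
    shift : ∀ k → ℙ (λ ω → Z ω ℕ.+ X ω ≡ suc k) ≈ a k + b (suc k)
    shift k = trans (P-split z+x z) (+-cong
      (P-cong (meas-∩ z+x z)
        ( (λ (eq , z) → z , ℕ.suc-injective (≡.trans (≡.cong (ℕ._+ _) (≡.sym z)) eq))
        , (λ (z , x) → ≡.cong₂ ℕ._+_ z x , z)))
      (P-cong (meas-∩ z+x (meas-∁ z))
        ( (λ {ω} (eq , ¬z) → ≡.trans (≡.cong (ℕ._+ X ω) (≡.sym (≤1∧≢1⇒≡0 (Z≤1 ω) ¬z))) eq , ¬z)
        , (λ {ω} (x , ¬z) → ≡.cong₂ ℕ._+_ (≤1∧≢1⇒≡0 (Z≤1 ω) ¬z) x , ¬z))))
      where z+x = meas-ℕ-+ Z≤1 z x (suc k)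
    b[1+N]≈0 : b (suc N) ≈ 0#
    b[1+N]≈0 = trans (P-cong (meas-∩ (x (suc N)) (meas-∁ z))
      ((λ {ω} (X≡1+N , _) → ℕ.1+n≰n (≡.subst (ℕ._≤ N) X≡1+N (X≤N ω))) , λ ())) ℙ-∅

  meas-∑ : ∀ n {Z : ℕ → Ω → ℕ} → (∀ i ω → Z i ω ℕ.≤ 1) → (∀ i → Measurable (λ ω → Z i ω ≡ 1)) →
    ∀ k → Measurable (λ ω → ∑ {n} (λ i → Z (toℕ i) ω) ≡ k)
  meas-∑ zero    Z≤1 z zero    = resp ((λ _ → ≡.refl) , λ _ → _) meas-U
  meas-∑ zero    Z≤1 z (suc k) = resp ((λ ()) , λ ()) meas-∅
  meas-∑ (suc n) Z≤1 z k       = meas-ℕ-+ (Z≤1 0) (z 0) (meas-∑ n (Z≤1 ∘ suc) (z ∘ suc)) k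

  mean-∑ : ∀ n {Z : ℕ → Ω → ℕ} → (∀ i ω → Z i ω ℕ.≤ 1) → (∀ i → Measurable (λ ω → Z i ω ≡ 1)) →
    mean n (λ ω → ∑ {n} (λ i → Z (toℕ i) ω)) ≈ sum {n} (λ i → ℙ (λ ω → Z (toℕ i) ω ≡ 1))
  mean-∑ zero    Z≤1 z = trans (+-identityʳ _) (zeroˡ _)
  mean-∑ (suc n) {Z} Z≤1 z = trans
    (mean-+ n (Z≤1 0) (λ ω → ∑≤n n _ (λ i → Z≤1 (suc (toℕ i)) ω)) (z 0) (meas-∑ n (Z≤1 ∘ suc) (z ∘ suc)))
    (+-congˡ (mean-∑ n (Z≤1 ∘ suc) (z ∘ suc)))

-- Quantifiers over a filtered and mapped list.

module _ {A B : Set} {P : Pred A 0ℓ} (P? : Unary.Decidable P) (f : A → B) {Q : Pred B 0ℓ} where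

  All-map-filter⁺ : ∀ {xs} → All (λ x → P x → Q (f x)) xs → All Q (List.map f (filter P? xs))
  All-map-filter⁺ []                  = []
  All-map-filter⁺ {x ∷ _} (px⇒q ∷ qs) with P? x
  ... | yes px = px⇒q px ∷ All-map-filter⁺ qs
  ... | no  _  = All-map-filter⁺ qs

  All-map-filter⁻ : ∀ xs → All Q (List.map f (filter P? xs)) → All (λ x → P x → Q (f x)) xs
  All-map-filter⁻ []       _  = []
  All-map-filter⁻ (x ∷ xs) qs with P? x
  All-map-filter⁻ (x ∷ xs) (q ∷ qs) | yes _  = (λ _ → q) ∷ All-map-filter⁻ xs qs
  All-map-filter⁻ (x ∷ xs) qs       | no ¬px = (λ px → contradiction px ¬px) ∷ All-map-filter⁻ xs qs

  Any-map-filter⁺ : ∀ {xs} → Any (λ x → P x ∧ Q (f x)) xs → Any Q (List.map f (filter P? xs))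
  Any-map-filter⁺ {x ∷ _} q with P? x
  Any-map-filter⁺ (here (_ , q))  | yes _  = here q
  Any-map-filter⁺ (there qs)      | yes _  = there (Any-map-filter⁺ qs)
  Any-map-filter⁺ (here (px , _)) | no ¬px = contradiction px ¬px
  Any-map-filter⁺ (there qs)      | no _   = Any-map-filter⁺ qs

  Any-map-filter⁻ : ∀ xs → Any Q (List.map f (filter P? xs)) → Any (λ x → P x ∧ Q (f x)) xs
  Any-map-filter⁻ (x ∷ xs) qs with P? x
  Any-map-filter⁻ (x ∷ xs) (here q)   | yes px = here (px , q)
  Any-map-filter⁻ (x ∷ xs) (there qs) | yes _  = there (Any-map-filter⁻ xs qs)
  Any-map-filter⁻ (x ∷ xs) qs         | no _   = there (Any-map-filter⁻ xs qs)

-- Floor and binary logarithm.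

module FloorLog (ℛ : Reals) where

  open Reals ℛ
  open OrderedFieldProperties orderedField
  open PartialOrderReasoning Order.poset

  ⌊⌋-unique : ∀ {x} n → fromℕ n ≤ x → x < fromℕ n + 1# → ⌊ x ⌋ ≡ + n
  ⌊⌋-unique {x} n n≤x x<n+1 with ⌊ x ⌋ | ⌊x⌋≤x x | x<⌊x⌋+1 x
  ... | + m      | m≤x | x<m+1 = ≡.cong +_ (ℕ.≤-antisym
    (fromℕ-cancel-≤ (begin-strict fromℕ m ≤⟨ m≤x ⟩ x <⟨ x<n+1 ⟩ fromℕ n + 1# ∎))
    (fromℕ-cancel-≤ (begin-strict fromℕ n ≤⟨ n≤x ⟩ x <⟨ x<m+1 ⟩ fromℕ m + 1# ∎)))
  ... | -[1+ m ] | _   | x<-m  = contradiction (Order.trans (fromℕ-nonneg n) n≤x) (<⇒≱ (begin-strict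
    x                         <⟨ x<-m ⟩
    - (1# + fromℕ m) + 1#     ≈⟨ solve 1 (λ m → :- (:1 :+ m) :+ :1 := :0 :- m) refl (fromℕ m) ⟩
    0# - fromℕ m              ≤⟨ x-y≤x (fromℕ-nonneg m) ⟩
    0#                        ∎))

  ⌊⌋-nonneg : ∀ {x} → 0# ≤ x → ∃ λ n → ⌊ x ⌋ ≡ + n ∧ fromℕ n ≤ x ∧ x < fromℕ n + 1#
  ⌊⌋-nonneg {x} 0≤x with ⌊ x ⌋ | ⌊x⌋≤x x | x<⌊x⌋+1 x
  ... | + n      | n≤x  | x<n+1 = n , ≡.refl , n≤x , x<n+1
  ... | -[1+ m ] | x≥-m | x<-m  = contradiction 0≤x (<⇒≱ (begin-strict
    x                         <⟨ x<-m ⟩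
    - (1# + fromℕ m) + 1#     ≈⟨ solve 1 (λ m → :- (:1 :+ m) :+ :1 := :0 :- m) refl (fromℕ m) ⟩
    0# - fromℕ m              ≤⟨ x-y≤x (fromℕ-nonneg m) ⟩
    0#                        ∎))

  -- The floor supplies the witness: n = ⌊x⁻¹⌋ satisfies x⁻¹ < n + 1.
  archimedean : ∀ {x} → 0# < x → ∃ λ n → fromℕ (suc n) ⁻¹ ≤ x
  archimedean {x} 0<x with ⌊⌋-nonneg (proj₁ (⁻¹-pos 0<x))
  ... | n , _ , _ , x⁻¹<n+1 = n , ≤-cancelˡ-* (⁻¹-pos 0<x) (begin
    x ⁻¹ * N ⁻¹   ≤⟨ *-monoʳ-≤ (proj₁ (⁻¹-pos (0<fromℕ-suc n))) (Order.trans (proj₁ x⁻¹<n+1) (Order.reflexive (+-comm (fromℕ n) 1#))) ⟩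
    N * N ⁻¹      ≈⟨ x*x⁻¹≈1 (0<fromℕ-suc n) ⟩
    1#            ≈⟨ x*x⁻¹≈1 0<x ⟨
    x * x ⁻¹      ≈⟨ *-comm x (x ⁻¹) ⟩
    x ⁻¹ * x      ∎)
    where N = fromℕ (suc n)

  log₂-mono-≤ : ∀ {x y} → 0# < x → x ≤ y → log₂ x ≤ log₂ y
  log₂-mono-≤ {x} {y} 0<x x≤y with x Order.≟ y
  ... | yes x≈y = Order.reflexive (log₂-cong x≈y)
  ... | no  x≉y = proj₁ (log₂-mono-< 0<x (x≤y , x≉y))

  log₂-1 : log₂ 1# ≈ 0#
  log₂-1 = begin-equality
    log₂ 1#                          ≈⟨ solve 1 (λ x → x := x :+ x :- x) refl (log₂ 1#) ⟩
    log₂ 1# + log₂ 1# - log₂ 1#      ≈⟨ +-congʳ (log₂-* 0<1 0<1) ⟨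
    log₂ (1# * 1#) - log₂ 1#         ≈⟨ +-congʳ (log₂-cong (*-identityʳ 1#)) ⟩
    log₂ 1# - log₂ 1#                ≈⟨ -‿inverseʳ (log₂ 1#) ⟩
    0#                               ∎

  -log₂-ε : ∀ k → - log₂ (ε k) ≈ fromℕ k
  -log₂-ε zero    = begin-equality
    - log₂ (ε 0)   ≈⟨ -‿cong (log₂-cong ε-zero) ⟩
    - log₂ 1#      ≈⟨ -‿cong log₂-1 ⟩
    - 0#           ≈⟨ solve 0 (:- :0 := :0) refl ⟩
    0#             ∎
  -log₂-ε (suc k) = begin-equality
    - log₂ (ε (suc k))                            ≈⟨ solve 1 (λ x → :- x := :1 :- (:1 :+ x)) refl (log₂ (ε (suc k))) ⟩
    1# - (1# + log₂ (ε (suc k)))                  ≈⟨ +-congˡ (-‿cong (+-congʳ log₂-2)) ⟨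
    1# - (log₂ (fromℕ 2) + log₂ (ε (suc k)))      ≈⟨ +-congˡ (-‿cong (log₂-* (0<fromℕ-suc 1) (0<ε (suc k)))) ⟨
    1# - log₂ (fromℕ 2 * ε (suc k))               ≈⟨ +-congˡ (-‿cong (log₂-cong double)) ⟩
    1# - log₂ (ε k)                               ≈⟨ +-congˡ (-log₂-ε k) ⟩
    1# + fromℕ k                                  ∎
    where
    double : fromℕ 2 * ε (suc k) ≈ ε k
    double = begin-equality
      fromℕ 2 * ε (suc k)      ≈⟨ *-congʳ fromℕ2 ⟩
      (1# + 1#) * ε (suc k)    ≈⟨ solve 1 (λ e → :2 :* e := e :+ e) refl (ε (suc k)) ⟩
      ε (suc k) + ε (suc k)    ≈⟨ ε-suc k ⟨
      ε k                      ∎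

  ≤ε⇒≤-log₂ : ∀ {x} k → 0# < x → x ≤ ε k → fromℕ k ≤ - log₂ x
  ≤ε⇒≤-log₂ {x} k 0<x x≤ε = begin
    fromℕ k        ≈⟨ -log₂-ε k ⟨
    - log₂ (ε k)   ≤⟨ neg-mono-≤ (log₂-mono-≤ 0<x x≤ε) ⟩
    - log₂ x       ∎

  ≤-log₂⇒≤ε : ∀ {x} k → fromℕ k ≤ - log₂ x → x ≤ ε k
  ≤-log₂⇒≤ε {x} k k≤-log = ≮⇒≥ λ ε<x → <⇒≱ (log₂-mono-< (0<ε k) ε<x) (neg-cancel-≤ (begin
    - log₂ (ε k)   ≈⟨ -log₂-ε k ⟩
    fromℕ k        ≤⟨ k≤-log ⟩
    - log₂ x       ∎))

  ⌊-log₂⌋⁺ : ∀ {x} k → 0# < x → ε (suc k) < x → x ≤ ε k → ⌊ - log₂ x ⌋ ≡ + k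
  ⌊-log₂⌋⁺ {x} k 0<x ε<x x≤ε = ⌊⌋-unique k (≤ε⇒≤-log₂ k 0<x x≤ε)
    (≰⇒> λ k+1≤-log → <⇒≱ ε<x (≤-log₂⇒≤ε (suc k) (Order.trans (Order.reflexive (+-comm 1# (fromℕ k))) k+1≤-log)))

  ⌊-log₂⌋⁻ : ∀ {x} → 0# < x → x < 1# → ∃ λ k → ⌊ - log₂ x ⌋ ≡ + k ∧ ε (suc k) < x ∧ x ≤ ε k
  ⌊-log₂⌋⁻ {x} 0<x x<1 with ⌊⌋-nonneg (≤ε⇒≤-log₂ 0 0<x (Order.trans (proj₁ x<1) (Order.reflexive (sym ε-zero))))
  ... | k , ⌊⌋≡k , k≤-log , -log<k+1 = k , ⌊⌋≡k
      , ≰⇒> (λ x≤ε → <⇒≱ -log<k+1 (Order.trans (Order.reflexive (+-comm (fromℕ k) 1#)) (≤ε⇒≤-log₂ (suc k) 0<x x≤ε)))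
      , ≤-log₂⇒≤ε k k≤-log

-- The fibres of ĥ on (0,1).  A band is an interval (base, top], cut into 2 ^ r
-- cells [base + j width, base + (j + 1) width); code j = 2 ^ r is the point top.
module HashCells (ℛ : Reals) (q r : ℕ) where

  open Reals ℛ
  open OrderedFieldProperties orderedField
  open FloorLog ℛ
  open HyperMinHash ℛ
  open Extrema Order.totalOrder using (min≤v⁺; min<v⁺; v≤min⁺; v<min⁺; min≤⊤; min≤xs)
  open DecTotalOrderProperties decTotalOrder using (<-respˡ-≈; <-respʳ-≈)
  open PartialOrderReasoning Order.poset

  -- For k < K the interval (2⁻ᵏ⁻¹, 2⁻ᵏ] has the uncapped value ρ = k + 1 and becomes `low k`. All k
  -- ≥ K share the cap 2^q = K + 1, so their union (0, 2⁻ᴷ] becomes the single band `last`.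
  K R : ℕ
  K = 2 ℕ.^ q ℕ.∸ 1
  R = 2 ℕ.^ r

  1+K≡2^q : suc K ≡ 2 ℕ.^ q
  1+K≡2^q = ℕ.m+[n∸m]≡n (ℕ.m^n>0 2 q)

  record Band : Set where
    constructor band
    field
      base top width : ℝ

    mark : ℕ → ℝ
    mark j = base + fromℕ j * width

    -- One set is upward closed and the other downward closed, so a minimum lies in the cell exactly
    -- when all values are `Above` and some value is `Below`. The conjunct `base < x` excludes the
    -- left end from cell 0, and `x ≤ top` cuts the extra cell j = 2 ^ r down to a point.
    Above Below : ℕ → Pred ℝ 0ℓ
    Above j x = base < x ∧ mark j ≤ x
    Below j x = x ≤ top ∧ x < mark (suc j)

    Cell : ℕ → Pred ℝ 0ℓ
    Cell j = Above j ∩ Below j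

  open Band public

  low : ℕ → Band
  low k = band (ε (suc k)) (ε k) (ε (suc k) * ε r)

  last : Band
  last = band 0# (ε K) (ε K * ε r)

  2^r*εr : fromℕ R * ε r ≈ 1#
  2^r*εr = trans (*-congʳ (fromℕ-homo-^ 2 r)) (2^*ε r)

  mark-R : ∀ {e} → fromℕ R * (e * ε r) ≈ e
  mark-R {e} = begin-equality
    fromℕ R * (e * ε r)   ≈⟨ solve 3 (λ R e d → R :* (e :* d) := e :* (R :* d)) refl (fromℕ R) e (ε r) ⟩
    e * (fromℕ R * ε r)   ≈⟨ *-congˡ 2^r*εr ⟩
    e * 1#                ≈⟨ *-identityʳ e ⟩
    e                     ∎

  mark-low-R : ∀ k → mark (low k) R ≈ ε k
  mark-low-R k = trans (+-congˡ mark-R) (sym (ε-suc k))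

  mark-last-R : mark last R ≈ ε K
  mark-last-R = trans (+-congˡ mark-R) (+-identityˡ _)

  private
    -- Here `y` stands for the argument of the floor in the second component of `ĥ`: the distance of
    -- `x` from the base, in units of the width. Both branches of `ĥ` have this affine form
    -- (`low-position`, `last-position`), so one argument serves both.
    module _ (ℓ : Band) {x y : ℝ} (0<w : 0# < width ℓ) (x≈ : x ≈ base ℓ + y * width ℓ) where

      position-≤ : ∀ {c} → c ≤ y → base ℓ + c * width ℓ ≤ x
      position-≤ {c} c≤y = begin
        base ℓ + c * width ℓ  ≤⟨ +-mono-≤ Order.refl (*-monoʳ-≤ (proj₁ 0<w) c≤y) ⟩
        base ℓ + y * width ℓ  ≈⟨ x≈ ⟨
        x                     ∎

      position-≥ : ∀ {c} → y ≤ c → x ≤ base ℓ + c * width ℓ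
      position-≥ {c} y≤c = begin
        x                     ≈⟨ x≈ ⟩
        base ℓ + y * width ℓ  ≤⟨ +-mono-≤ Order.refl (*-monoʳ-≤ (proj₁ 0<w) y≤c) ⟩
        base ℓ + c * width ℓ  ∎

      ⌊position⌋⁺ : ∀ j → Cell ℓ j x → ⌊ y ⌋ ≡ + j
      ⌊position⌋⁺ j ((_ , mark≤x) , (_ , x<mark)) = ⌊⌋-unique j
        (≮⇒≥ λ y<j → <⇒≱ (begin-strict
          x                              ≈⟨ x≈ ⟩
          base ℓ + y * width ℓ           ≈⟨ +-comm _ _ ⟩
          y * width ℓ + base ℓ           <⟨ +-monoˡ-< (base ℓ) (<-respˡ-≈ (*-comm _ _) (<-respʳ-≈ (*-comm _ _) (*-monoˡ-< 0<w y<j))) ⟩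
          fromℕ j * width ℓ + base ℓ     ≈⟨ +-comm _ _ ⟩
          mark ℓ j                       ∎) mark≤x)
        (≰⇒> λ j+1≤y → <⇒≱ x<mark (position-≤ (Order.trans (Order.reflexive (+-comm 1# (fromℕ j))) j+1≤y)))

      ⌊position⌋⁻ : base ℓ < x → x ≤ top ℓ → mark ℓ R ≈ top ℓ →
        ∃ λ j → j ℕ.< suc R ∧ ⌊ y ⌋ ≡ + j ∧ Cell ℓ j x
      ⌊position⌋⁻ base<x x≤top mark-R≈top with ⌊⌋-nonneg 0≤y
        where
        0≤y : 0# ≤ y
        0≤y = ≮⇒≥ λ y<0 → <⇒≱ base<x (begin
          x                         ≤⟨ position-≥ (proj₁ y<0) ⟩
          base ℓ + 0# * width ℓ     ≈⟨ solve 2 (λ b w → b :+ :0 :* w := b) refl (base ℓ) (width ℓ) ⟩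
          base ℓ                    ∎)
      ... | j , ⌊y⌋≡j , j≤y , y<j+1 = j , s≤s (ℕ.≮⇒≥ R≮j) , ⌊y⌋≡j
          , (base<x , position-≤ j≤y) , (x≤top , x<mark)
        where
        x<mark : x < mark ℓ (suc j)
        x<mark = begin-strict
          x                                     ≈⟨ x≈ ⟩
          base ℓ + y * width ℓ                  ≈⟨ solve 3 (λ b y w → b :+ y :* w := w :* y :+ b) refl (base ℓ) y (width ℓ) ⟩
          width ℓ * y + base ℓ                  <⟨ +-monoˡ-< (base ℓ) (*-monoˡ-< 0<w y<j+1) ⟩
          width ℓ * (fromℕ j + 1#) + base ℓ     ≈⟨ solve 3 (λ b j w → w :* (j :+ :1) :+ b := b :+ (:1 :+ j) :* w) refl (base ℓ) (fromℕ j) (width ℓ) ⟩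
          mark ℓ (suc j)                        ∎
        R≮j : ¬ (R ℕ.< j)
        R≮j R<j = <⇒≱ (begin-strict
          mark ℓ R                              ≈⟨ solve 3 (λ b j w → b :+ j :* w := w :* j :+ b) refl (base ℓ) (fromℕ R) (width ℓ) ⟩
          width ℓ * fromℕ R + base ℓ            <⟨ +-monoˡ-< (base ℓ) (*-monoˡ-< 0<w R<y) ⟩
          width ℓ * y + base ℓ                  ≈⟨ solve 3 (λ b y w → w :* y :+ b := b :+ y :* w) refl (base ℓ) y (width ℓ) ⟩
          base ℓ + y * width ℓ                  ≈⟨ x≈ ⟨
          x                                     ∎) (Order.trans x≤top (Order.reflexive (sym mark-R≈top)))
          where
          R<y : fromℕ R < y
          R<y = begin-strict
            fromℕ R         ≈⟨ +-identityˡ (fromℕ R) ⟨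
            0# + fromℕ R    <⟨ +-monoˡ-< (fromℕ R) 0<1 ⟩
            1# + fromℕ R    ≤⟨ fromℕ-mono-≤ R<j ⟩
            fromℕ j         ≤⟨ j≤y ⟩
            y               ∎

    low-position : ∀ k {x} → x ≈ ε (suc k) + (x * 2^ (+ suc k) - 1#) * 2^ (+ r) * (ε (suc k) * ε r)
    low-position k {x} = sym (begin-equality
      ε (suc k) + (x * 2^ (+ suc k) - 1#) * 2^ (+ r) * (ε (suc k) * ε r)
        ≈⟨ solve 5 (λ x e d T W → e :+ (x :* T :- :1) :* W :* (e :* d) :=
             e :+ (x :* (T :* e) :- e) :* (W :* d)) refl x (ε (suc k)) (ε r) (2^ (+ suc k)) (2^ (+ r)) ⟩
      ε (suc k) + (x * (2^ (+ suc k) * ε (suc k)) - ε (suc k)) * (2^ (+ r) * ε r)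
        ≈⟨ +-congˡ (*-cong (+-congʳ (*-congˡ (2^*ε (suc k)))) (2^*ε r)) ⟩
      ε (suc k) + (x * 1# - ε (suc k)) * 1#
        ≈⟨ solve 2 (λ x e → e :+ (x :* :1 :- e) :* :1 := x) refl x (ε (suc k)) ⟩
      x ∎)

    last-position : ∀ {x} → x ≈ 0# + x * 2^ (+ K) * 2^ (+ r) * (ε K * ε r)
    last-position {x} = sym (begin-equality
      0# + x * 2^ (+ K) * 2^ (+ r) * (ε K * ε r)
        ≈⟨ solve 5 (λ x e d T W → :0 :+ x :* T :* W :* (e :* d) := x :* (T :* e) :* (W :* d))
             refl x (ε K) (ε r) (2^ (+ K)) (2^ (+ r)) ⟩
      x * (2^ (+ K) * ε K) * (2^ (+ r) * ε r)
        ≈⟨ *-cong (*-congˡ (2^*ε K)) (2^*ε r) ⟩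
      x * 1# * 1#
        ≈⟨ solve 1 (λ x → x :* :1 :* :1 := x) refl x ⟩
      x ∎)

    0<low-width : ∀ k → 0# < width (low k)
    0<low-width k = *-pos (0<ε (suc k)) (0<ε r)

    0<last-width : 0# < width last
    0<last-width = *-pos (0<ε K) (0<ε r)

    ρ-low : ∀ {x} k → ⌊ - log₂ x ⌋ ≡ + k → k ℕ.< K → ρ q x ≡ + suc k
    ρ-low k eq k<K rewrite eq | ℕ.+-comm k 1 =
      ≡.cong +_ (ℕ.m≤n⇒m⊓n≡m (ℕ.≤-trans k<K (ℕ.m∸n≤m (2 ℕ.^ q) 1)))

    ρ-last : ∀ {x} k → ⌊ - log₂ x ⌋ ≡ + k → K ℕ.≤ k → ρ q x ≡ + (2 ℕ.^ q)
    ρ-last k eq K≤k rewrite eq | ℕ.+-comm k 1 =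
      ≡.cong +_ (ℕ.m≥n⇒m⊓n≡n (ℕ.≤-trans (ℕ.≤-reflexive (≡.sym 1+K≡2^q)) (s≤s K≤k)))

    ĥ-low : ∀ {x} k → ⌊ - log₂ x ⌋ ≡ + k → k ℕ.< K →
      ĥ q r x ≡ (+ suc k , ⌊ (x * 2^ (+ suc k) - 1#) * 2^ (+ r) ⌋)
    ĥ-low {x} k eq k<K with ρ q x ℤ.<? + (2 ℕ.^ q) | ρ-low {x} k eq k<K
    ... | yes _ | ρ≡ = ≡.cong (λ i → i , σ r (x * 2^ i - 1#)) ρ≡
    ... | no ρ≮ | ρ≡ = contradiction
      (≡.subst₂ ℤ._<_ (≡.sym ρ≡) (≡.cong +_ 1+K≡2^q) (ℤ.+<+ (s≤s k<K))) ρ≮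

    ĥ-last : ∀ {x} k → ⌊ - log₂ x ⌋ ≡ + k → K ℕ.≤ k →
      ĥ q r x ≡ (+ (2 ℕ.^ q) , ⌊ x * 2^ (+ K) * 2^ (+ r) ⌋)
    ĥ-last {x} k eq K≤k with ρ q x ℤ.<? + (2 ℕ.^ q) | ρ-last {x} k eq K≤k
    ... | yes ρ< | ρ≡ = contradiction ρ< (ℤ.<-irrefl ρ≡)
    ... | no _   | _  = ≡.refl

    ε-mono : ∀ {j k} → j ℕ.≤ k → ε k ≤ ε j
    ε-mono {j} {k} j≤k = begin
      ε k                     ≡⟨ ≡.cong ε (≡.sym (ℕ.m+[n∸m]≡n j≤k)) ⟩
      ε (j ℕ.+ (k ℕ.∸ j))     ≈⟨ ε-+ j (k ℕ.∸ j) ⟩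
      ε j * ε (k ℕ.∸ j)       ≤⟨ *-monoˡ-≤ (0≤ε j) (ε≤1 (k ℕ.∸ j)) ⟩
      ε j * 1#                ≈⟨ *-identityʳ (ε j) ⟩
      ε j                     ∎

  ĥ-low⁺ : ∀ {x} k j → k ℕ.< K → 0# < x → Cell (low k) j x → ĥ q r x ≡ (+ suc k , + j)
  ĥ-low⁺ k j k<K 0<x x∈ = ≡.trans
    (ĥ-low k (⌊-log₂⌋⁺ k 0<x (proj₁ (proj₁ x∈)) (proj₁ (proj₂ x∈))) k<K)
    (≡.cong (+ suc k ,_) (⌊position⌋⁺ (low k) (0<low-width k) (low-position k) j x∈))

  ĥ-last⁺ : ∀ {x} j → 0# < x → x < 1# → Cell last j x → ĥ q r x ≡ (+ (2 ℕ.^ q) , + j)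
  ĥ-last⁺ {x} j 0<x x<1 x∈ =
    let k , eq , ε<x , _ = ⌊-log₂⌋⁻ 0<x x<1
        -- If k < K, then x > ε (k + 1) ≥ ε K, beyond the top of `last`.
        K≤k = ℕ.≮⇒≥ (λ k<K → <⇒≱ ε<x (Order.trans (proj₁ (proj₂ x∈)) (ε-mono k<K)))
    in ≡.trans (ĥ-last k eq K≤k) (≡.cong (+ (2 ℕ.^ q) ,_) (⌊position⌋⁺ last 0<last-width last-position j x∈))

  private
    LowCode LastCode : Pred ℝ 0ℓ
    LowCode x  = ∃ λ k → k ℕ.< K ∧ ∃ λ j → j ℕ.< suc R ∧ ĥ q r x ≡ (+ suc k , + j) ∧ Cell (low k) j x
    LastCode x = ∃ λ j → j ℕ.< suc R ∧ ĥ q r x ≡ (+ (2 ℕ.^ q) , + j) ∧ Cell last j x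

    low-code : ∀ {x} k → ⌊ - log₂ x ⌋ ≡ + k → k ℕ.< K → ε (suc k) < x → x ≤ ε k → LowCode x
    low-code k eq k<K ε<x x≤ε =
      let j , j≤R , ⌊⌋≡j , x∈ = ⌊position⌋⁻ (low k) (0<low-width k) (low-position k) ε<x x≤ε (mark-low-R k)
      in k , k<K , j , j≤R , ≡.trans (ĥ-low k eq k<K) (≡.cong (+ suc k ,_) ⌊⌋≡j) , x∈

    last-code : ∀ {x} k → ⌊ - log₂ x ⌋ ≡ + k → K ℕ.≤ k → 0# < x → x ≤ ε k → LastCode x
    last-code k eq K≤k 0<x x≤ε =
      let j , j≤R , ⌊⌋≡j , x∈ = ⌊position⌋⁻ last 0<last-width last-position 0<x (Order.trans x≤ε (ε-mono K≤k)) mark-last-R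
      in j , j≤R , ≡.trans (ĥ-last k eq K≤k) (≡.cong (+ (2 ℕ.^ q) ,_) ⌊⌋≡j) , x∈

  ĥ⁻ : ∀ {x} → 0# < x → x < 1# → LowCode x ⊎ LastCode x
  ĥ⁻ {x} 0<x x<1 =
    let k , eq , ε<x , x≤ε = ⌊-log₂⌋⁻ 0<x x<1
    in [ (λ k<K → inj₁ (low-code k eq k<K ε<x x≤ε)) , (λ K≤k → inj₂ (last-code k eq K≤k 0<x x≤ε)) ] (ℕ.<-≤-connex k K)

  -- Families of cells, indexed by the codes (k + 1, j) and (2 ^ q, j).
  ⋃-cells : {A : Set} → ℕ → (Band → ℕ → Pred A 0ℓ) → Pred A 0ℓ
  ⋃-cells n C = ⋃< K (λ k → ⋃< n (C (low k))) ∪ ⋃< n (C last)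

  ⋃-cells-map : ∀ {A B : Set} {n} {C : Band → ℕ → Pred A 0ℓ} {D : Band → ℕ → Pred B 0ℓ} {a b} →
    (∀ ℓ j → C ℓ j a → D ℓ j b) → ⋃-cells n C a → ⋃-cells n D b
  ⋃-cells-map f (inj₁ (k , k<K , j , j<n , c)) = inj₁ (k , k<K , j , j<n , f (low k) j c)
  ⋃-cells-map f (inj₂ (j , j<n , c))           = inj₂ (j , j<n , f last j c)

  SameCell : ℝ → Band → ℕ → Pred ℝ 0ℓ
  SameCell x ℓ j y = Cell ℓ j x ∧ Cell ℓ j y

  private
    same-code⇒same-cell : ∀ {x y c} → c ≡ ĥ q r x → c ≡ ĥ q r y →
      LowCode x ⊎ LastCode x → LowCode y ⊎ LastCode y → ⋃-cells (suc R) (SameCell x) y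
    same-code⇒same-cell cx cy (inj₁ (k , k<K , j , j≤R , ĥx , x∈)) (inj₁ (_ , _ , _ , _ , ĥy , y∈)) =
      let eq = ≡.trans (≡.trans (≡.sym ĥy) (≡.sym cy)) (≡.trans cx ĥx)
      in inj₁ (k , k<K , j , j≤R , x∈ , ≡.subst₂ (λ k j → Cell (low k) j _)
           (ℕ.suc-injective (ℤ.+-injective (≡.cong proj₁ eq))) (ℤ.+-injective (≡.cong proj₂ eq)) y∈)
    same-code⇒same-cell cx cy (inj₂ (j , j≤R , ĥx , x∈)) (inj₂ (_ , _ , ĥy , y∈)) =
      let eq = ≡.trans (≡.trans (≡.sym ĥy) (≡.sym cy)) (≡.trans cx ĥx)
      in inj₂ (j , j≤R , x∈ , ≡.subst (λ j → Cell last j _) (ℤ.+-injective (≡.cong proj₂ eq)) y∈)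
    same-code⇒same-cell cx cy (inj₁ (k , k<K , _ , _ , ĥx , _)) (inj₂ (_ , _ , ĥy , _)) = contradiction
      (ℤ.+-injective (≡.cong proj₁ (≡.trans (≡.trans (≡.sym ĥx) (≡.sym cx)) (≡.trans cy ĥy))))
      (ℕ.<⇒≢ (≡.subst (suc k ℕ.<_) 1+K≡2^q (s≤s k<K)))
    same-code⇒same-cell cx cy (inj₂ (_ , _ , ĥx , _)) (inj₁ (k , k<K , _ , _ , ĥy , _)) = contradiction
      (ℤ.+-injective (≡.cong proj₁ (≡.trans (≡.trans (≡.sym ĥy) (≡.sym cy)) (≡.trans cx ĥx))))
      (ℕ.<⇒≢ (≡.subst (suc k ℕ.<_) 1+K≡2^q (s≤s k<K)))

  ĥ≡⇒same-cell : ∀ {x y c} → 0# < x → x < 1# → 0# < y → y < 1# →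
    c ≡ ĥ q r x → c ≡ ĥ q r y → ⋃-cells (suc R) (SameCell x) y
  ĥ≡⇒same-cell 0<x x<1 0<y y<1 cx cy = same-code⇒same-cell cx cy (ĥ⁻ 0<x x<1) (ĥ⁻ 0<y y<1)

  same-cell⇒ĥ≡ : ∀ {x y n} → 0# < x → x < 1# → 0# < y → y < 1# →
    ⋃-cells n (SameCell x) y → ĥ q r x ≡ ĥ q r y
  same-cell⇒ĥ≡ 0<x x<1 0<y y<1 (inj₁ (k , k<K , j , _ , x∈ , y∈)) =
    ≡.trans (ĥ-low⁺ k j k<K 0<x x∈) (≡.sym (ĥ-low⁺ k j k<K 0<y y∈))
  same-cell⇒ĥ≡ 0<x x<1 0<y y<1 (inj₂ (j , _ , x∈ , y∈)) =
    ≡.trans (ĥ-last⁺ j 0<x x<1 x∈) (≡.sym (ĥ-last⁺ j 0<y y<1 y∈))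

  -- Minima of lists, and collisions in one bucket.

  min-cell⁺ : ∀ ℓ j x xs → Cell ℓ j (min x xs) → All (Above ℓ j) (x ∷ xs) ∧ Any (Below ℓ j) (x ∷ xs)
  min-cell⁺ ℓ j x xs ((base<m , mark≤m) , below) =
      All.map (λ m≤ → (begin-strict base ℓ <⟨ base<m ⟩ min x xs ≤⟨ m≤ ⟩ _ ∎) , Order.trans mark≤m m≤)
        (min≤⊤ x xs ∷ min≤xs x xs)
    , attained
    where
    attained : Any (Below ℓ j) (x ∷ xs)
    attained with Extrema.argmin-sel Order.totalOrder id x xs
    ... | inj₁ m≡x  = here (≡.subst (Below ℓ j) m≡x below)
    ... | inj₂ m∈xs = there (Any.map (λ m≡ → ≡.subst (Below ℓ j) m≡ below) m∈xs)

  min-cell⁻ : ∀ ℓ j x xs → All (Above ℓ j) (x ∷ xs) → Any (Below ℓ j) (x ∷ xs) → Cell ℓ j (min x xs)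
  min-cell⁻ ℓ j x xs (a ∷ as) b =
      (v<min⁺ (proj₁ a) (All.map proj₁ as) , v≤min⁺ (proj₂ a) (All.map proj₂ as))
    , (min≤v⁺ x xs (Any.toSum (Any.map proj₁ b)) , min<v⁺ x xs (Any.toSum (Any.map proj₂ b)))

  collide⁻ : ∀ u v → collide u v ≡ 1 → ∃ λ c → just c ≡ u ∧ just c ≡ v
  collide⁻ (just u) (just v) eq with ≡-dec ℤ._≟_ ℤ._≟_ u v
  ... | yes ≡.refl = u , ≡.refl , ≡.refl

  collide⁺ : ∀ c → collide (just c) (just c) ≡ 1
  collide⁺ c with ≡-dec ℤ._≟_ ℤ._≟_ c c
  ... | yes _  = ≡.refl
  ... | no c≢c = contradiction ≡.refl c≢c

  map-minimum⁻ : ∀ (f : ℝ → ℤ ∧ ℤ) xs {c} → just c ≡ Maybe.map f (minimum xs) →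
    ∃₂ λ y ys → xs ≡ y ∷ ys ∧ c ≡ f (min y ys)
  map-minimum⁻ f (y ∷ ys) ≡.refl = y , ys , ≡.refl , ≡.refl

  module Bucket {𝕊 : Set} (p i : ℕ) where

    rescale : ℝ → ℝ
    rescale y = y * 2^ (+ p) - fromℕ i

    unscale : ℝ → ℝ
    unscale t = (fromℕ i + t) * ε p

    rescale-unscale : ∀ t → rescale (unscale t) ≈ t
    rescale-unscale t = begin-equality
      (fromℕ i + t) * ε p * 2^ (+ p) - fromℕ i
        ≈⟨ solve 4 (λ i t e T → (i :+ t) :* e :* T :- i := (i :+ t) :* (T :* e) :- i) refl (fromℕ i) t (ε p) (2^ (+ p)) ⟩
      (fromℕ i + t) * (2^ (+ p) * ε p) - fromℕ i
        ≈⟨ +-congʳ (*-congˡ (2^*ε p)) ⟩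
      (fromℕ i + t) * 1# - fromℕ i
        ≈⟨ solve 2 (λ i t → (i :+ t) :* :1 :- i := t) refl (fromℕ i) t ⟩
      t ∎

    unscale-rescale : ∀ y → unscale (rescale y) ≈ y
    unscale-rescale y = begin-equality
      (fromℕ i + (y * 2^ (+ p) - fromℕ i)) * ε p
        ≈⟨ solve 4 (λ i y e T → (i :+ (y :* T :- i)) :* e := y :* (T :* e)) refl (fromℕ i) y (ε p) (2^ (+ p)) ⟩
      y * (2^ (+ p) * ε p)
        ≈⟨ *-congˡ (2^*ε p) ⟩
      y * 1#
        ≈⟨ *-identityʳ y ⟩
      y ∎

    rescale-mono : ∀ {x y} → x ≤ y → rescale x ≤ rescale y
    rescale-mono x≤y = +-monoˡ-≤ _ (*-monoʳ-≤ (proj₁ (0<2^ p)) x≤y)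

    unscale-mono : ∀ {s t} → s ≤ t → unscale s ≤ unscale t
    unscale-mono s≤t = *-monoʳ-≤ (0≤ε p) (+-mono-≤ Order.refl s≤t)

    rescale-≤⁺ : ∀ {y t} → y ≤ unscale t → rescale y ≤ t
    rescale-≤⁺ {y} {t} y≤ = Order.trans (rescale-mono y≤) (Order.reflexive (rescale-unscale t))

    rescale-≤⁻ : ∀ {y t} → rescale y ≤ t → y ≤ unscale t
    rescale-≤⁻ {y} {t} ≤t = Order.trans (Order.reflexive (sym (unscale-rescale y))) (unscale-mono ≤t)

    ≤-rescale⁺ : ∀ {y t} → unscale t ≤ y → t ≤ rescale y
    ≤-rescale⁺ {y} {t} ≤y = Order.trans (Order.reflexive (sym (rescale-unscale t))) (rescale-mono ≤y)

    ≤-rescale⁻ : ∀ {y t} → t ≤ rescale y → unscale t ≤ y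
    ≤-rescale⁻ {y} {t} t≤ = Order.trans (unscale-mono t≤) (Order.reflexive (unscale-rescale y))

    -- The initial piece (0, t) of the rescaled bucket; t = 1 gives the bucket itself.
    Inside : ℝ → Pred ℝ 0ℓ
    Inside t y = 0# < rescale y ∧ rescale y < t

    module _ (h : 𝕊 → ℝ) where

      private
        left : fromℕ i * 2^ (ℤ.- + p) ≈ unscale 0#
        left = *-cong (sym (+-identityʳ _)) (2^-≈ε p)

        right : fromℕ (suc i) * 2^ (ℤ.- + p) ≈ unscale 1#
        right = *-cong (+-comm 1# (fromℕ i)) (2^-≈ε p)

      InBucket⁺ : ∀ {a} → Inside 1# (h a) → InBucket p q r h i a
      InBucket⁺ (0< , <1) =
          <-respˡ-≈ (sym left) (≰⇒> λ y≤ → <⇒≱ 0< (rescale-≤⁺ y≤))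
        , <-respʳ-≈ (sym right) (≰⇒> λ ≤y → <⇒≱ <1 (≤-rescale⁺ ≤y))

      InBucket⁻ : ∀ {a} → InBucket p q r h i a → Inside 1# (h a)
      InBucket⁻ (left< , <right) =
          ≰⇒> (λ ≤0 → <⇒≱ (<-respˡ-≈ left left<) (rescale-≤⁻ ≤0))
        , ≰⇒> (λ 1≤ → <⇒≱ (<-respʳ-≈ right <right) (≤-rescale⁻ 1≤))

      -- Expresses "the bucket is nonempty and its minimum lies in the cell" element by element,
      -- without `filter` and `min`, so that measurability follows from finite intersections and
      -- unions. The `Any` part supplies nonemptiness.
      MinInCell : List 𝕊 → Band → ℕ → Set
      MinInCell A ℓ j = All (λ a → Inside 1# (h a) → Above ℓ j (rescale (h a))) A ∧
                        Any (λ a → Inside 1# (h a) ∧ Below ℓ j (rescale (h a))) A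

      values : List 𝕊 → List ℝ
      values A = rescaledHashes p q r h A i

      values-inside : ∀ A → All (λ x → 0# < x ∧ x < 1#) (values A)
      values-inside A = All-map-filter⁺ (inBucket? p q r h i) (rescale ∘ h) {Q = λ x → 0# < x ∧ x < 1#} (All.universal (λ a → InBucket⁻) A)

      MinInCell⁺ : ∀ A {x xs} → values A ≡ x ∷ xs → ∀ ℓ j → Cell ℓ j (min x xs) → MinInCell A ℓ j
      MinInCell⁺ A {x} {xs} eq ℓ j c =
          All.map (λ above inside → above (InBucket⁺ inside))
            (All-map-filter⁻ (inBucket? p q r h i) (rescale ∘ h) {Q = Above ℓ j} A (≡.subst (All (Above ℓ j)) (≡.sym eq) (proj₁ (min-cell⁺ ℓ j x xs c))))
        , Any.map (λ (inside , below) → InBucket⁻ inside , below)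
            (Any-map-filter⁻ (inBucket? p q r h i) (rescale ∘ h) {Q = Below ℓ j} A (≡.subst (Any (Below ℓ j)) (≡.sym eq) (proj₂ (min-cell⁺ ℓ j x xs c))))

      MinInCell⁻ : ∀ A {x xs} → values A ≡ x ∷ xs → ∀ ℓ j → MinInCell A ℓ j → Cell ℓ j (min x xs)
      MinInCell⁻ A {x} {xs} eq ℓ j (above , below) = min-cell⁻ ℓ j x xs
        (≡.subst (All (Above ℓ j)) eq (All-map-filter⁺ (inBucket? p q r h i) (rescale ∘ h) {Q = Above ℓ j}
          (All.map (λ above inside → above (InBucket⁻ inside)) above)))
        (≡.subst (Any (Below ℓ j)) eq (Any-map-filter⁺ (inBucket? p q r h i) (rescale ∘ h) {Q = Below ℓ j}
          (Any.map (λ (inside , below) → InBucket⁺ inside , below) below)))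

      MinInCell-nonempty : ∀ A ℓ j → MinInCell A ℓ j → ∃₂ λ x xs → values A ≡ x ∷ xs
      MinInCell-nonempty A ℓ j (_ , below) = nonempty (Any-map-filter⁺ (inBucket? p q r h i) (rescale ∘ h) {Q = Below ℓ j}
        (Any.map (λ (inside , below) → InBucket⁺ inside , below) below))
        where
        nonempty : ∀ {Q : Pred ℝ 0ℓ} {xs : List ℝ} → Any Q xs → ∃₂ λ y ys → xs ≡ y ∷ ys
        nonempty (here _)  = _ , _ , ≡.refl
        nonempty (there _) = _ , _ , ≡.refl

      BothInCell : List 𝕊 → List 𝕊 → Band → ℕ → Set
      BothInCell A B ℓ j = MinInCell A ℓ j ∧ MinInCell B ℓ j

      min-inside : ∀ A {x} {xs} → values A ≡ x ∷ xs → 0# < min x xs ∧ min x xs < 1#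
      min-inside A {x} {xs} eq with ≡.subst (All (λ x → 0# < x ∧ x < 1#)) eq (values-inside A)
      ... | (0<x , x<1) ∷ all = v<min⁺ 0<x (All.map proj₁ all) , min<v⁺ x xs (inj₁ x<1)

    module _ (h : 𝕊 → ℝ) (A B : List 𝕊) where

      private
        ⋃-BothInCell : ℕ → Set
        ⋃-BothInCell n = ⋃-cells n (λ ℓ j h → BothInCell h A B ℓ j) h

        nonempty : ∀ {n} → ⋃-BothInCell n →
          (∃₂ λ x xs → values h A ≡ x ∷ xs) ∧ (∃₂ λ y ys → values h B ≡ y ∷ ys)
        nonempty (inj₁ (k , _ , j , _ , a , b)) =
          MinInCell-nonempty h A (low k) j a , MinInCell-nonempty h B (low k) j b
        nonempty (inj₂ (j , _ , a , b))         =
          MinInCell-nonempty h A last j a , MinInCell-nonempty h B last j b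

      collision⇒cell : Z p q r h A B i ≡ 1 → ⋃-BothInCell (suc R)
      collision⇒cell Z≡1 =
        let c , cA , cB          = collide⁻ (sketch p q r h A i) (sketch p q r h B i) Z≡1
            _ , _ , eqA , c≡ĥA   = map-minimum⁻ (ĥ q r) (values h A) cA
            _ , _ , eqB , c≡ĥB   = map-minimum⁻ (ĥ q r) (values h B) cB
            0<x , x<1            = min-inside h A eqA
            0<y , y<1            = min-inside h B eqB
        in ⋃-cells-map {C = SameCell _} {D = λ ℓ j h → BothInCell h A B ℓ j} (λ ℓ j (a , b) → MinInCell⁺ h A eqA ℓ j a , MinInCell⁺ h B eqB ℓ j b)
             (ĥ≡⇒same-cell 0<x x<1 0<y y<1 c≡ĥA c≡ĥB)

      -- This converse serves measurability: with both inclusions a collision equals a finite union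
      -- of cell events, so `ĥ` itself never has to be shown measurable.
      cell⇒collision : ∀ {n} → ⋃-BothInCell n → Z p q r h A B i ≡ 1
      cell⇒collision c =
        let (x , xs , eqA) , (y , ys , eqB) = nonempty c
            0<x , x<1      = min-inside h A eqA
            0<y , y<1      = min-inside h B eqB
            ĥ≡             = same-cell⇒ĥ≡ 0<x x<1 0<y y<1
                               (⋃-cells-map {C = λ ℓ j h → BothInCell h A B ℓ j} {D = SameCell _} (λ ℓ j (a , b) → MinInCell⁻ h A eqA ℓ j a , MinInCell⁻ h B eqB ℓ j b) c)
        in ≡.trans (≡.cong₂ (λ xs ys → collide (Maybe.map (ĥ q r) (minimum xs)) (Maybe.map (ĥ q r) (minimum ys))) eqA eqB)
             (≡.trans (≡.cong (λ c → collide (just c) (just (ĥ q r (min y ys)))) ĥ≡) (collide⁺ (ĥ q r (min y ys))))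

-- Lists as injective families of indices.

All-lookup⁻ : ∀ {a p} {A : Set a} {P : Pred A p} (xs : List A) → (∀ j → P (lookup xs j)) → All P xs
All-lookup⁻ []       _  = []
All-lookup⁻ (x ∷ xs) ps = ps zero ∷ All-lookup⁻ xs (ps ∘ suc)

-- `Independent` takes an injective family of indices, and `lookup` into a list with distinct keys
-- is one. Keys are used because the entries will carry a threshold as second component.
lookup-key-injective : ∀ {a b} {A : Set a} {B : Set b} (f : A → B) (xs : List A) →
  Unique (List.map f xs) → Injective _≡_ _≡_ (f ∘ lookup xs)
lookup-key-injective f (x ∷ xs) (x∉ ∷ u) {zero}  {zero}  eq = ≡.refl
lookup-key-injective f (x ∷ xs) (x∉ ∷ u) {zero}  {suc j} eq =
  contradiction eq (All.lookup (All.map⁻ x∉) (∈-lookup j))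
lookup-key-injective f (x ∷ xs) (x∉ ∷ u) {suc i} {zero}  eq =
  contradiction (≡.sym eq) (All.lookup (All.map⁻ x∉) (∈-lookup i))
lookup-key-injective f (x ∷ xs) (x∉ ∷ u) {suc i} {suc j} eq =
  ≡.cong suc (lookup-key-injective f xs u eq)

-- Rays as Borel sets.

module BorelSets (ℛ : Reals) where

  open Reals ℛ
  open OrderedFieldProperties orderedField
  open FloorLog ℛ
  open Probability ℛ using (Borel; halfLine; complement; union)
  open PartialOrderReasoning Order.poset

  -- No constructor gives the whole line; it is a half-line together with its complement, by
  -- decidability of the order.
  Borel-U : Borel U
  Borel-U = Probability.resp ((λ _ → _) , λ {x} _ → cover x) (union halves borel)
    where
    halves : ℕ → Pred ℝ 0ℓ
    halves zero    = _≤ 0#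
    halves (suc _) = ∁ (_≤ 0#)
    borel : ∀ k → Borel (halves k)
    borel zero    = halfLine 0#
    borel (suc _) = complement (halfLine 0#)
    cover : ∀ x → ⋃ ℕ halves x
    cover x with x Order.≤? 0#
    ... | yes x≤0 = 0 , x≤0
    ... | no  x≰0 = 1 , x≰0

  open DecidableMeasurable Borel Probability.resp Borel-U complement union public

  borel-≤ : ∀ t → Measurable (_≤ t)
  borel-≤ t = halfLine t , λ x → x Order.≤? t

  -- (-∞, t) is the union of the (-∞, t - 1/(k + 1)].
  borel-< : ∀ t → Measurable (_< t)
  borel-< t = Probability.resp (below , approach)
    (union (λ k → _≤ (t - fromℕ (suc k) ⁻¹)) (λ k → halfLine _)) , λ x → x <? t
    where
    below : ⋃ ℕ (λ k → _≤ (t - fromℕ (suc k) ⁻¹)) ⊆ (_< t)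
    below {x} (k , x≤) = ≰⇒> λ t≤x → <⇒≱ (⁻¹-pos (0<fromℕ-suc k)) (≤-cancelʳ-+ (t - δ) (begin
      δ + (t - δ)    ≈⟨ solve 2 (λ t d → d :+ (t :- d) := t) refl t δ ⟩
      t              ≤⟨ t≤x ⟩
      x              ≤⟨ x≤ ⟩
      t - δ          ≈⟨ +-identityˡ (t - δ) ⟨
      0# + (t - δ)   ∎))
      where δ = fromℕ (suc k) ⁻¹
    approach : (_< t) ⊆ ⋃ ℕ (λ k → _≤ (t - fromℕ (suc k) ⁻¹))
    approach {x} x<t =
      let k , δ≤t-x = archimedean 0<t-x
      in k , ≤-by (x≤y⇒0≤y-x δ≤t-x)
           (solve 3 (λ x t d → t :- d :- x := t :- x :- d) refl x t (fromℕ (suc k) ⁻¹))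
      where
      0<t-x : 0# < t - x
      0<t-x = ≰⇒> λ t-x≤0 → <⇒≱ x<t (≤-by (x≤y⇒0≤y-x t-x≤0)
        (solve 2 (λ x t → x :- t := :0 :- (t :- x)) refl x t))

  borel-> : ∀ t → Measurable (t <_)
  borel-> t = resp (≰⇒> , <⇒≱) (meas-∁ (borel-≤ t))

  borel-≥ : ∀ t → Measurable (t ≤_)
  borel-≥ t = resp (≮⇒≥ , λ t≤x x<t → <⇒≱ x<t t≤x) (meas-∁ (borel-< t))

-- The probability of a collision, and the expected number of collisions.

module RandomHash (ℛ : Reals) (𝒫 : ProbabilitySpace ℛ) {𝕊 : Set}
  (h : 𝕊 → ProbabilitySpace.Ω 𝒫 → Reals.ℝ ℛ) (H : IsRandomHash ℛ 𝒫 h)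
  (p q r : ℕ) where

  open Reals ℛ
  open OrderedFieldProperties orderedField
  open ProbabilitySpace 𝒫
  open ProbabilityProperties ℛ 𝒫
  open IsRandomHash H hiding (measurable)
  open HashCells ℛ q r
  open PartialOrderReasoning Order.poset
  module 𝔅 = BorelSets ℛ

  pull : ∀ {B} → 𝔅.Measurable B → ∀ a → Measurable (h a ⊢ B)
  pull b a = IsRandomHash.measurable H a (𝔅.measurable b) , λ ω → 𝔅.decide b (h a ω)

  -- The probability that one hash value misses the piece (0, t) of a bucket (`P-outside`).
  clear : ℝ → ℝ
  clear t = 1# - ε p * t

  clear-cong : ∀ {s t} → s ≈ t → clear s ≈ clear t
  clear-cong s≈t = +-congˡ (-‿cong (*-congˡ s≈t))

  clear-anti : ∀ {s t} → s ≤ t → clear t ≤ clear s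
  clear-anti s≤t = +-mono-≤ Order.refl (neg-mono-≤ (*-monoˡ-≤ (0≤ε p) s≤t))

  0≤clear : ∀ {t} → t ≤ 1# → 0# ≤ clear t
  0≤clear {t} t≤1 = x≤y⇒0≤y-x (begin
    ε p * t    ≤⟨ *-monoˡ-≤ (0≤ε p) t≤1 ⟩
    ε p * 1#   ≈⟨ *-identityʳ (ε p) ⟩
    ε p        ≤⟨ ε≤1 p ⟩
    1#         ∎)

  clear≤1 : ∀ {t} → 0# ≤ t → clear t ≤ 1#
  clear≤1 0≤t = x-y≤x (*-nonneg (0≤ε p) 0≤t)

  module _ (i : ℕ) where

    open Bucket {𝕊} p i

    rescale-<⁺ : ∀ {y t} → y < unscale t → rescale y < t
    rescale-<⁺ y< = ≰⇒> λ t≤ → <⇒≱ y< (≤-rescale⁻ t≤)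

    rescale-<⁻ : ∀ {y t} → rescale y < t → y < unscale t
    rescale-<⁻ <t = ≰⇒> λ ≤y → <⇒≱ <t (≤-rescale⁺ ≤y)

    <-rescale⁺ : ∀ {y t} → unscale t < y → t < rescale y
    <-rescale⁺ <y = ≰⇒> λ ≤t → <⇒≱ <y (rescale-≤⁻ ≤t)

    <-rescale⁻ : ∀ {y t} → t < rescale y → unscale t < y
    <-rescale⁻ t< = ≰⇒> λ y≤ → <⇒≱ t< (rescale-≤⁺ y≤)

    borel-Inside : ∀ t → 𝔅.Measurable (Inside t)
    borel-Inside t = 𝔅.meas-∩ (𝔅.resp (<-rescale⁺ , <-rescale⁻) (𝔅.borel-> (unscale 0#)))
                              (𝔅.resp (rescale-<⁺ , rescale-<⁻) (𝔅.borel-< (unscale t)))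

    borel-Above : ∀ ℓ j → 𝔅.Measurable (λ y → Above ℓ j (rescale y))
    borel-Above ℓ j = 𝔅.meas-∩ (𝔅.resp (<-rescale⁺ , <-rescale⁻) (𝔅.borel-> _))
                               (𝔅.resp (≤-rescale⁺ , ≤-rescale⁻) (𝔅.borel-≥ _))

    borel-Below : ∀ ℓ j → 𝔅.Measurable (λ y → Below ℓ j (rescale y))
    borel-Below ℓ j = 𝔅.meas-∩ (𝔅.resp (rescale-≤⁺ , rescale-≤⁻) (𝔅.borel-≤ _))
                               (𝔅.resp (rescale-<⁺ , rescale-<⁻) (𝔅.borel-< _))

    meas-MinInCell : ∀ C ℓ j → Measurable (λ ω → MinInCell (λ a → h a ω) C ℓ j)
    meas-MinInCell C ℓ j = meas-∩
      (meas-All (λ a → meas-⇒ (pull (borel-Inside 1#) a) (pull (borel-Above ℓ j) a)) C)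
      (meas-Any (λ a → meas-∩ (pull (borel-Inside 1#) a) (pull (borel-Below ℓ j) a)) C)

    meas-BothInCell : ∀ A B ℓ j → Measurable (λ ω → BothInCell (λ a → h a ω) A B ℓ j)
    meas-BothInCell A B ℓ j = meas-∩ (meas-MinInCell A ℓ j) (meas-MinInCell B ℓ j)

    meas-⋃-cells : ∀ n {C : Band → ℕ → Pred Ω 0ℓ} → (∀ ℓ j → Measurable (C ℓ j)) → Measurable (⋃-cells n C)
    meas-⋃-cells n c = meas-∪ (meas-⋃< K (λ k → meas-⋃< n (c (low k)))) (meas-⋃< n (c last))

    Collision : List 𝕊 → List 𝕊 → Pred Ω 0ℓ
    Collision A B ω = HyperMinHash.Z ℛ p q r (λ a → h a ω) A B i ≡ 1

    -- ⋃-cells is applied to realisations of h on one side, to outcomes on the other.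
    collision-cells : ∀ {A B} → Collision A B ⊆ ⋃-cells (suc R) (λ ℓ j ω → BothInCell (λ a → h a ω) A B ℓ j)
    collision-cells {A} {B} {ω} Z≡1 = ⋃-cells-map {C = λ ℓ j h → BothInCell h A B ℓ j}
      {D = λ ℓ j ω → BothInCell (λ a → h a ω) A B ℓ j} (λ _ _ c → c) (collision⇒cell (λ a → h a ω) A B Z≡1)

    cells-collision : ∀ {A B} → ⋃-cells (suc R) (λ ℓ j ω → BothInCell (λ a → h a ω) A B ℓ j) ⊆ Collision A B
    cells-collision {A} {B} {ω} c = cell⇒collision (λ a → h a ω) A B {suc R}
      (⋃-cells-map {C = λ ℓ j ω → BothInCell (λ a → h a ω) A B ℓ j}
        {D = λ ℓ j h → BothInCell h A B ℓ j} (λ _ _ c → c) c)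

    meas-Collision : ∀ A B → Measurable (Collision A B)
    meas-Collision A B = resp (cells-collision , collision-cells)
      (meas-⋃-cells (suc R) (meas-BothInCell A B))

    -- For 0 ≤ s ≤ t ≤ 1, `Avoid s C` without `Avoid t C` says that the bucket of C is nonempty with
    -- rescaled minimum in [s, t). Cell probabilities thus reduce to those of `Avoid`, which
    -- independence turns into powers.
    Avoid : ℝ → List 𝕊 → Pred Ω 0ℓ
    Avoid t C ω = All (λ a → ¬ Inside t (h a ω)) C

    meas-Avoid : ∀ t C → Measurable (Avoid t C)
    meas-Avoid t = meas-All (λ a → meas-∁ (pull (borel-Inside t) a))

    module _ (i<2^p : i ℕ.< 2 ℕ.^ p) where

      private
        0≤unscale : ∀ {t} → 0# ≤ t → 0# ≤ unscale t
        0≤unscale 0≤t = *-nonneg (+-nonneg (fromℕ-nonneg i) 0≤t) (0≤ε p)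

        unscale≤1 : ∀ {t} → t ≤ 1# → unscale t ≤ 1#
        unscale≤1 {t} t≤1 = begin
          (fromℕ i + t) * ε p       ≤⟨ *-monoʳ-≤ (0≤ε p) (+-mono-≤ Order.refl t≤1) ⟩
          -- The last bucket ends at 1, which keeps every threshold within [0,1], the range of
          -- `uniform`.
          (fromℕ i + 1#) * ε p      ≤⟨ *-monoʳ-≤ (0≤ε p) (1+fromℕ≤ i<2^p) ⟩
          fromℕ (2 ℕ.^ p) * ε p     ≈⟨ *-congʳ (fromℕ-homo-^ 2 p) ⟩
          2^ (+ p) * ε p            ≈⟨ 2^*ε p ⟩
          1#                        ∎

        Between : 𝕊 → ℝ → ℝ → Pred Ω 0ℓ
        Between a s t ω = unscale s ≤ h a ω ∧ h a ω ≤ unscale t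

        meas-Between : ∀ a s t → Measurable (Between a s t)
        meas-Between a s t = pull (𝔅.meas-∩ (𝔅.borel-≥ (unscale s)) (𝔅.borel-≤ (unscale t))) a

        P-Between : ∀ a {s t} → 0# ≤ s → s ≤ t → t ≤ 1# → ℙ (Between a s t) ≈ ε p * (t - s)
        P-Between a {s} {t} 0≤s s≤t t≤1 = trans
          (uniform a (0≤unscale 0≤s) (unscale-mono s≤t) (unscale≤1 t≤1))
          (solve 4 (λ i s t e → (i :+ t) :* e :- (i :+ s) :* e := e :* (t :- s)) refl (fromℕ i) s t (ε p))

        P-point : ∀ a {s} → 0# ≤ s → s ≤ 1# → ℙ (Between a s s) ≈ 0#
        P-point a {s} 0≤s s≤1 = trans (P-Between a 0≤s Order.refl s≤1)
          (solve 2 (λ e s → e :* (s :- s) := :0) refl (ε p) s)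

      -- Uniformity is stated for closed intervals. The open piece differs by its end points, which
      -- are closed intervals of length zero; these coincide for t = 0, hence the union bound in
      -- `endpoints≈0`.
      P-Inside : ∀ a {t} → 0# ≤ t → t ≤ 1# → ℙ (h a ⊢ Inside t) ≈ ε p * t
      P-Inside a {t} 0≤t t≤1 = begin-equality
        ℙ (h a ⊢ Inside t)                    ≈⟨ +-identityʳ _ ⟨
        ℙ (h a ⊢ Inside t) + 0#               ≈⟨ +-congˡ endpoints≈0 ⟨
        ℙ (h a ⊢ Inside t) + ℙ Endpoints      ≈⟨ P-∪ inside meas-Endpoints disjoint ⟨
        ℙ ((h a ⊢ Inside t) ∪ Endpoints)      ≈⟨ P-cong (meas-∪ inside meas-Endpoints) (to , from) ⟩
        ℙ (Between a 0# t)                    ≈⟨ P-Between a Order.refl 0≤t t≤1 ⟩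
        ε p * (t - 0#)                        ≈⟨ solve 2 (λ e t → e :* (t :- :0) := e :* t) refl (ε p) t ⟩
        ε p * t                               ∎
        where
        inside = pull (borel-Inside t) a
        Endpoints = Between a 0# 0# ∪ Between a t t
        meas-Endpoints = meas-∪ (meas-Between a 0# 0#) (meas-Between a t t)
        endpoints≈0 : ℙ Endpoints ≈ 0#
        endpoints≈0 = Order.antisym (begin
          ℙ Endpoints                                 ≤⟨ P-∪-≤ (meas-Between a 0# 0#) (meas-Between a t t) ⟩
          ℙ (Between a 0# 0#) + ℙ (Between a t t)     ≈⟨ +-cong (P-point a Order.refl 0≤1) (P-point a 0≤t t≤1) ⟩
          0# + 0#                                     ≈⟨ +-identityˡ 0# ⟩
          0#                                          ∎) (ℙ-nonneg (measurable meas-Endpoints))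
        disjoint : (h a ⊢ Inside t) Unary.⊥ Endpoints
        disjoint ((0< , _) , inj₁ (_ , ≤0)) = <⇒≱ 0< (rescale-≤⁺ ≤0)
        disjoint ((_ , <t) , inj₂ (t≤ , _)) = <⇒≱ <t (≤-rescale⁺ t≤)
        to : (h a ⊢ Inside t) ∪ Endpoints ⊆ Between a 0# t
        to (inj₁ (0< , <t))         = ≤-rescale⁻ (proj₁ 0<) , rescale-≤⁻ (proj₁ <t)
        to (inj₂ (inj₁ (0≤ , ≤0)))  = 0≤ , Order.trans ≤0 (unscale-mono 0≤t)
        to (inj₂ (inj₂ (t≤ , ≤t)))  = Order.trans (unscale-mono 0≤t) t≤ , ≤t
        from : Between a 0# t ⊆ (h a ⊢ Inside t) ∪ Endpoints
        from {ω} (0≤ , ≤t) with h a ω Order.≤? unscale 0# | unscale t Order.≤? h a ω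
        ... | yes ≤0 | _      = inj₂ (inj₁ (0≤ , ≤0))
        ... | no  _  | yes t≤ = inj₂ (inj₂ (t≤ , ≤t))
        ... | no  ≰0 | no  t≰ = inj₁ (<-rescale⁺ (≰⇒> ≰0) , rescale-<⁺ (≰⇒> t≰))

      P-outside : ∀ a {t} → 0# ≤ t → t ≤ 1# → ℙ (h a ⊢ ∁ (Inside t)) ≈ clear t
      P-outside a {t} 0≤t t≤1 = begin-equality
        P∁                         ≈⟨ solve 2 (λ x y → y := x :+ y :- x) refl PI P∁ ⟩
        PI + P∁ - PI               ≈⟨ +-congʳ (+-cong (P-cong inside ((_ ,_) , proj₂)) (P-cong (meas-∁ inside) ((_ ,_) , proj₂))) ⟩
        ℙ (U ∩ (h a ⊢ Inside t)) + ℙ (U ∩ ∁ (h a ⊢ Inside t)) - PI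
                                   ≈⟨ +-congʳ (P-split meas-U inside) ⟨
        ℙ U - PI                   ≈⟨ +-cong ℙ-U (-‿cong (P-Inside a 0≤t t≤1)) ⟩
        1# - ε p * t               ∎
        where
        inside = pull (borel-Inside t) a
        PI = ℙ (h a ⊢ Inside t)
        P∁ = ℙ (h a ⊢ ∁ (Inside t))

      private
        -- Each element carries its own threshold, so a single appeal to independence covers A with
        -- one threshold and B with another.
        Avoids : List (𝕊 ∧ ℝ) → Pred Ω 0ℓ
        Avoids L ω = All (λ (a , t) → ¬ Inside t (h a ω)) L

        P-Avoids : ∀ L → Unique (List.map proj₁ L) →
          ℙ (Avoids L) ≈ product (λ j → ℙ (h (proj₁ (lookup L j)) ⊢ ∁ (Inside (proj₂ (lookup L j)))))
        P-Avoids L u = trans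
          (P-cong (meas-All (λ (a , t) → meas-∁ (pull (borel-Inside t) a)) L)
            ((λ all j → All.lookup all (∈-lookup j)) , All-lookup⁻ L))
          (independent (proj₁ ∘ lookup L) (lookup-key-injective proj₁ L u)
            (λ j → ∁ (Inside (proj₂ (lookup L j))))
            (λ j → 𝔅.measurable (𝔅.meas-∁ (borel-Inside _))))

        product-++ : ∀ {s t} → 0# ≤ s → s ≤ 1# → 0# ≤ t → t ≤ 1# → ∀ A B →
          let L = List.map (_, s) A ++ List.map (_, t) B in
          product (λ j → ℙ (h (proj₁ (lookup L j)) ⊢ ∁ (Inside (proj₂ (lookup L j))))) ≈
          clear s ^ length A * clear t ^ length B
        product-++ 0≤s s≤1 0≤t t≤1 []      []      = sym (*-identityˡ 1#)
        product-++ 0≤s s≤1 0≤t t≤1 []      (b ∷ B) = trans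
          (*-cong (P-outside b 0≤t t≤1) (product-++ 0≤s s≤1 0≤t t≤1 [] B))
          (solve 2 (λ t z → t :* (:1 :* z) := :1 :* (t :* z)) refl _ _)
        product-++ 0≤s s≤1 0≤t t≤1 (a ∷ A) B       = trans
          (*-cong (P-outside a 0≤s s≤1) (product-++ 0≤s s≤1 0≤t t≤1 A B))
          (sym (*-assoc _ _ _))

      -- Uniqueness and disjointness make the keys `A ++ B` distinct, so the hash values of both
      -- sets are jointly independent and the probability factors.
      P-Avoid² : ∀ {A B s t} → Unique A → Unique B → Disjoint A B →
        0# ≤ s → s ≤ 1# → 0# ≤ t → t ≤ 1# →
        ℙ (Avoid s A ∩ Avoid t B) ≈ clear s ^ length A * clear t ^ length B
      P-Avoid² {A} {B} {s} {t} uA uB A#B 0≤s s≤1 0≤t t≤1 = begin-equality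
        ℙ (Avoid s A ∩ Avoid t B)
          ≈⟨ P-cong (meas-∩ (meas-Avoid s A) (meas-Avoid t B))
               ( (λ (a , b) → All.++⁺ (All.map⁺ a) (All.map⁺ b))
               , (λ all → All.map⁻ (All.++⁻ˡ (List.map (_, s) A) all) , All.map⁻ (All.++⁻ʳ (List.map (_, s) A) all))) ⟩
        ℙ (Avoids L)
          ≈⟨ P-Avoids L (≡.subst Unique (≡.sym keys) (Unique.++⁺ uA uB A#B)) ⟩
        product (λ j → ℙ (h (proj₁ (lookup L j)) ⊢ ∁ (Inside (proj₂ (lookup L j)))))
          ≈⟨ product-++ 0≤s s≤1 0≤t t≤1 A B ⟩
        clear s ^ length A * clear t ^ length B ∎
        where
        L = List.map (_, s) A ++ List.map (_, t) B
        key-map : ∀ t C → List.map proj₁ (List.map (_, t) C) ≡ C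
        key-map t C = ≡.trans (≡.sym (map-∘ C)) (map-id C)
        keys : List.map proj₁ L ≡ A ++ B
        keys = ≡.trans (map-++ proj₁ (List.map (_, s) A) _) (≡.cong₂ _++_ (key-map s A) (key-map t B))

      module _ {A B : List 𝕊} (uA : Unique A) (uB : Unique B) (A#B : Disjoint A B)
        (m d : ℕ) (∣A∣ : length A ≡ suc (m ℕ.+ d)) (∣B∣ : length B ≡ m) where

        private
          n : ℕ
          n = suc (m ℕ.+ d)

          -- The exponent is n + m - 1.
          tail : ℝ → ℝ
          tail t = clear t ^ (m ℕ.+ d ℕ.+ m)

          0≤tail : ∀ {t} → t ≤ 1# → 0# ≤ tail t
          0≤tail t≤1 = ^-nonneg (m ℕ.+ d ℕ.+ m) (0≤clear t≤1)

        BothIn[_,_⟩ : ℝ → ℝ → Pred Ω 0ℓ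
        BothIn[ s , t ⟩ = (Avoid s A ∩ ∁ (Avoid t A)) ∩ (Avoid s B ∩ ∁ (Avoid t B))

        meas-BothIn : ∀ s t → Measurable BothIn[ s , t ⟩
        meas-BothIn s t = meas-∩ (meas-∩ (meas-Avoid s A) (meas-∁ (meas-Avoid t A)))
                                 (meas-∩ (meas-Avoid s B) (meas-∁ (meas-Avoid t B)))

        P-BothIn : ∀ {s t} → 0# ≤ s → s ≤ t → t ≤ 1# →
          ℙ BothIn[ s , t ⟩ ≤ ε 1 * (fromℕ n * (ε p * (t - s) * (tail s - tail t)))
        P-BothIn {s} {t} 0≤s s≤t t≤1 = begin
          ℙ BothIn[ s , t ⟩
            ≈⟨ P-differences (meas-Avoid s A) (meas-Avoid t A) (meas-Avoid s B) (meas-Avoid t B) weaken weaken ⟩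
          (ℙ (Avoid s A ∩ Avoid s B) - ℙ (Avoid t A ∩ Avoid s B)) -
          (ℙ (Avoid s A ∩ Avoid t B) - ℙ (Avoid t A ∩ Avoid t B))
            ≈⟨ +-cong (+-cong (P-both 0≤s s≤1 0≤s s≤1) (-‿cong (P-both 0≤t t≤1 0≤s s≤1)))
                 (-‿cong (+-cong (P-both 0≤s s≤1 0≤t t≤1) (-‿cong (P-both 0≤t t≤1 0≤t t≤1)))) ⟩
          (x ^ n * x ^ m - y ^ n * x ^ m) - (x ^ n * y ^ m - y ^ n * y ^ m)
            ≈⟨ solve 4 (λ a b a′ b′ → (a :* b :- a′ :* b) :- (a :* b′ :- a′ :* b′) := :1 :* ((a :- a′) :* (b :- b′)))
                 refl (x ^ n) (x ^ m) (y ^ n) (y ^ m) ⟩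
          1# * ((x ^ n - y ^ n) * (x ^ m - y ^ m))
            -- Writing 1 as 1/2 + 1/2 produces the factor 2 on the left of `power-differences`.
            ≈⟨ *-congʳ (trans (sym ε-zero) (ε-suc 0)) ⟩
          (ε 1 + ε 1) * ((x ^ n - y ^ n) * (x ^ m - y ^ m))
            ≈⟨ solve 2 (λ e z → (e :+ e) :* z := e :* (:2 :* z)) refl (ε 1) _ ⟩
          ε 1 * ((1# + 1#) * ((x ^ n - y ^ n) * (x ^ m - y ^ m)))
            ≤⟨ *-monoˡ-≤ (0≤ε 1) (power-differences m d (0≤clear t≤1) (clear-anti s≤t)) ⟩
          ε 1 * (fromℕ n * ((x - y) * (tail s - tail t)))
            ≈⟨ *-congˡ (*-congˡ (*-congʳ (solve 3 (λ u s t → :1 :- u :* s :- (:1 :- u :* t) := u :* (t :- s)) refl (ε p) s t))) ⟩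
          ε 1 * (fromℕ n * (ε p * (t - s) * (tail s - tail t))) ∎
          where
          x = clear s
          y = clear t
          s≤1 = Order.trans s≤t t≤1
          0≤t = Order.trans 0≤s s≤t
          weaken : ∀ {C ω} → Avoid t C ω → Avoid s C ω
          weaken = All.map (λ avoid (0< , <s) → avoid (0< , (begin-strict _ <⟨ <s ⟩ s ≤⟨ s≤t ⟩ t ∎)))
          P-both : ∀ {s t} → 0# ≤ s → s ≤ 1# → 0# ≤ t → t ≤ 1# →
            ℙ (Avoid s A ∩ Avoid t B) ≈ clear s ^ n * clear t ^ m
          P-both {s} {t} 0≤s s≤1 0≤t t≤1 = trans (P-Avoid² uA uB A#B 0≤s s≤1 0≤t t≤1)
            (reflexive (≡.cong₂ (λ a b → clear s ^ a * clear t ^ b) ∣A∣ ∣B∣))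

        -- Closed at `mark ℓ j` even for j = 0, where `Cell` leaves out the base. This makes room
        -- for the point that is the top of the next lower band.
        BothInMarks : Band → ℕ → Pred Ω 0ℓ
        BothInMarks ℓ j = BothIn[ mark ℓ j , mark ℓ (suc j) ⟩

        meas-BothInMarks : ∀ ℓ j → Measurable (BothInMarks ℓ j)
        meas-BothInMarks ℓ j = meas-BothIn (mark ℓ j) (mark ℓ (suc j))

        -- Equal widths give every cell the same constant `c`, so only the values of `tail` at the
        -- two ends of the band survive, and the one at the upper end is dropped.
        P-band : ∀ ℓ → 0# ≤ base ℓ → 0# ≤ width ℓ → mark ℓ R ≤ 1# →
          ℙ (⋃< R (BothInMarks ℓ)) ≤ ε 1 * (fromℕ n * (ε p * width ℓ)) * tail (base ℓ)
        P-band ℓ 0≤b 0≤w markR≤1 = begin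
          ℙ (⋃< R (BothInMarks ℓ))
            -- `tail` decreases along the band, so the telescoping function is its negative
            -- multiple.
            ≤⟨ P-⋃<-telescope R (λ j → - (c * tail (mark ℓ j))) (meas-BothInMarks ℓ) cell ⟩
          - (c * tail (mark ℓ R)) - (- (c * tail (mark ℓ 0)))
            ≈⟨ solve 3 (λ c x y → :- (c :* x) :- (:- (c :* y)) := c :* y :- c :* x) refl c _ _ ⟩
          c * tail (mark ℓ 0) - c * tail (mark ℓ R)
            ≤⟨ x-y≤x (*-nonneg 0≤c (0≤tail markR≤1)) ⟩
          c * tail (mark ℓ 0)
            ≈⟨ *-congˡ (^-cong (m ℕ.+ d ℕ.+ m) (clear-cong
                 (solve 2 (λ b w → b :+ :0 :* w := b) refl (base ℓ) (width ℓ)))) ⟩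
          c * tail (base ℓ) ∎
          where
          c = ε 1 * (fromℕ n * (ε p * width ℓ))
          0≤c : 0# ≤ c
          0≤c = *-nonneg (0≤ε 1) (*-nonneg (fromℕ-nonneg n) (*-nonneg (0≤ε p) 0≤w))
          mark-mono : ∀ {j k} → j ℕ.≤ k → mark ℓ j ≤ mark ℓ k
          mark-mono j≤k = +-mono-≤ Order.refl (*-monoʳ-≤ 0≤w (fromℕ-mono-≤ j≤k))
          cell : ∀ j → j ℕ.< R → ℙ (BothInMarks ℓ j) ≤ - (c * tail (mark ℓ (suc j))) - (- (c * tail (mark ℓ j)))
          cell j j<R = begin
            ℙ (BothInMarks ℓ j)
              ≤⟨ P-BothIn (Order.trans 0≤b (x≤x+y (*-nonneg (fromℕ-nonneg j) 0≤w)))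
                   (mark-mono (ℕ.n≤1+n j)) (Order.trans (mark-mono j<R) markR≤1) ⟩
            ε 1 * (fromℕ n * (ε p * (mark ℓ (suc j) - mark ℓ j) * (tail (mark ℓ j) - tail (mark ℓ (suc j)))))
              ≈⟨ solve 8 (λ h n u b w j x y → h :* (n :* (u :* (b :+ (:1 :+ j) :* w :- (b :+ j :* w)) :* (x :- y))) :=
                   :- (h :* (n :* (u :* w)) :* y) :- (:- (h :* (n :* (u :* w)) :* x))) refl
                   (ε 1) (fromℕ n) (ε p) (base ℓ) (width ℓ) (fromℕ j) (tail (mark ℓ j)) (tail (mark ℓ (suc j))) ⟩
            - (c * tail (mark ℓ (suc j))) - (- (c * tail (mark ℓ j))) ∎

        private
          -- The probability that A has no hash in the piece (0, 2⁻ᵏ⁻¹) of the bucket. Hence F (k +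
          -- 1) - F k is the probability that the minimum of A lies in [2⁻ᵏ⁻², 2⁻ᵏ⁻¹), one band
          -- below `low k`.
          F : ℕ → ℝ
          F k = clear (ε (suc k)) ^ n

        -- The factor 1/2 shrinks the length of `low k` to that of the next lower band. Once the
        -- factor yᵐ ≤ 1 is dropped from `tail`, the bound of `P-band` is 2⁻ʳ n (x - y) yⁿ⁻¹, and
        -- `tangent-below` compares it with an increment of `F`.
        P-low : ∀ k → ℙ (⋃< R (BothInMarks (low k))) ≤ ε r * F (suc k) - ε r * F k
        P-low k = begin
          ℙ (⋃< R (BothInMarks (low k)))
            ≤⟨ P-band (low k) (0≤ε (suc k)) (*-nonneg (0≤ε (suc k)) (0≤ε r))
                 (Order.trans (Order.reflexive (mark-low-R k)) (ε≤1 k)) ⟩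
          ε 1 * (fromℕ n * (ε p * (ε (suc k) * ε r))) * tail (ε (suc k))
            ≤⟨ *-monoˡ-≤ (*-nonneg (0≤ε 1) (*-nonneg (fromℕ-nonneg n) (*-nonneg (0≤ε p) (*-nonneg (0≤ε (suc k)) (0≤ε r))))) tail≤ ⟩
          ε 1 * (fromℕ n * (ε p * (ε (suc k) * ε r))) * y ^ (m ℕ.+ d)
            ≈⟨ solve 6 (λ h n u e d z → h :* (n :* (u :* (e :* d))) :* z := d :* (n :* (u :* (h :* e) :* z)))
                 refl (ε 1) (fromℕ n) (ε p) (ε (suc k)) (ε r) (y ^ (m ℕ.+ d)) ⟩
          ε r * (fromℕ n * (ε p * (ε 1 * ε (suc k)) * y ^ (m ℕ.+ d)))
            ≈⟨ *-congˡ (*-congˡ (*-congʳ x-y)) ⟨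
          ε r * (fromℕ n * ((x - y) * y ^ (m ℕ.+ d)))
            ≤⟨ *-monoˡ-≤ (0≤ε r) (tangent-below (m ℕ.+ d) (0≤clear (ε≤1 (suc k))) (clear-anti (ε-anti (suc k)))) ⟩
          ε r * (F (suc k) - F k)
            ≈⟨ solve 3 (λ e x y → e :* (x :- y) := e :* x :- e :* y) refl (ε r) (F (suc k)) (F k) ⟩
          ε r * F (suc k) - ε r * F k ∎
          where
          x = clear (ε (suc (suc k)))
          y = clear (ε (suc k))
          x-y : x - y ≈ ε p * (ε 1 * ε (suc k))
          x-y = begin-equality
            x - y
              ≈⟨ +-congˡ (-‿cong (clear-cong (ε-suc (suc k)))) ⟩
            x - clear (ε (suc (suc k)) + ε (suc (suc k)))
              ≈⟨ solve 2 (λ u e → :1 :- u :* e :- (:1 :- u :* (e :+ e)) := u :* e) refl (ε p) (ε (suc (suc k))) ⟩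
            ε p * ε (suc (suc k))
              ≈⟨ *-congˡ (ε-+ 1 (suc k)) ⟩
            ε p * (ε 1 * ε (suc k)) ∎
          tail≤ : tail (ε (suc k)) ≤ y ^ (m ℕ.+ d)
          tail≤ = begin
            y ^ (m ℕ.+ d ℕ.+ m)      ≈⟨ ^-homo-+ y (m ℕ.+ d) m ⟩
            y ^ (m ℕ.+ d) * y ^ m    ≤⟨ *-monoˡ-≤ (^-nonneg (m ℕ.+ d) (0≤clear (ε≤1 (suc k))))
                                          (^-≤1 m (0≤clear (ε≤1 (suc k))) (clear≤1 (0≤ε (suc k)))) ⟩
            y ^ (m ℕ.+ d) * 1#       ≈⟨ *-identityʳ _ ⟩
            y ^ (m ℕ.+ d)            ∎

        -- `tail` is bounded by 1, and the factor 1/2 joins the length 2⁻ᴷ of the band to give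
        -- exponent K + 1 = 2^q.
        P-last : ℙ (⋃< R (BothInMarks last)) ≤ fromℕ n * ε (p ℕ.+ 2 ℕ.^ q ℕ.+ r)
        P-last = begin
          ℙ (⋃< R (BothInMarks last))
            ≤⟨ P-band last Order.refl (*-nonneg (0≤ε K) (0≤ε r)) (Order.trans (Order.reflexive mark-last-R) (ε≤1 K)) ⟩
          ε 1 * (fromℕ n * (ε p * (ε K * ε r))) * tail 0#
            ≤⟨ *-monoˡ-≤ (*-nonneg (0≤ε 1) (*-nonneg (fromℕ-nonneg n) (*-nonneg (0≤ε p) (*-nonneg (0≤ε K) (0≤ε r)))))
                 (^-≤1 (m ℕ.+ d ℕ.+ m) (0≤clear 0≤1) (clear≤1 Order.refl)) ⟩
          ε 1 * (fromℕ n * (ε p * (ε K * ε r))) * 1#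
            ≈⟨ solve 5 (λ h n u e d → h :* (n :* (u :* (e :* d))) :* :1 := n :* (u :* (h :* e) :* d))
                 refl (ε 1) (fromℕ n) (ε p) (ε K) (ε r) ⟩
          fromℕ n * (ε p * (ε 1 * ε K) * ε r)
            ≈⟨ *-congˡ (*-congʳ (*-congˡ (ε-+ 1 K))) ⟨
          fromℕ n * (ε p * ε (suc K) * ε r)
            ≡⟨ ≡.cong (λ k → fromℕ n * (ε p * ε k * ε r)) 1+K≡2^q ⟩
          fromℕ n * (ε p * ε (2 ℕ.^ q) * ε r)
            ≈⟨ *-congˡ (trans (ε-+ (p ℕ.+ 2 ℕ.^ q) r) (*-congʳ (ε-+ p (2 ℕ.^ q)))) ⟨
          fromℕ n * ε (p ℕ.+ 2 ℕ.^ q ℕ.+ r) ∎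

        private
          MinIn : List 𝕊 → Ω → Band → ℕ → Set
          MinIn C ω = MinInCell (λ a → h a ω) C

          avoid-below : ∀ {s C ω} → s ≤ 1# → All (λ a → Inside 1# (h a ω) → s ≤ rescale (h a ω)) C → Avoid s C ω
          avoid-below s≤1 = All.map λ above (0< , <s) →
            <⇒≱ <s (above (0< , (begin-strict _ <⟨ <s ⟩ _ ≤⟨ s≤1 ⟩ 1# ∎)))

          hit-above : ∀ {t C ω} → Any (λ a → Inside 1# (h a ω) ∧ rescale (h a ω) < t) C → ¬ Avoid t C ω
          hit-above any avoid =
            let ¬inside , ((0< , _) , <t) = All.lookupAny avoid any in ¬inside (0< , <t)

          BothMinIn : Band → ℕ → Pred Ω 0ℓ
          BothMinIn ℓ j ω = BothInCell (λ a → h a ω) A B ℓ j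

          -- Stated for general s and t because `boundary` sends code R of one band to the first
          -- cell of another.
          both-in : ∀ ℓ j {s t ω} → s ≤ 1# → (∀ {x} → Above ℓ j x → s ≤ x) → (∀ {x} → Below ℓ j x → x < t) →
            BothMinIn ℓ j ω → BothIn[ s , t ⟩ ω
          both-in ℓ j {s} {t} {ω} s≤1 above⇒≤ below⇒< (a , b) = in-half-open a , in-half-open b
            where
            in-half-open : ∀ {C} → MinIn C ω ℓ j → (Avoid s C ∩ ∁ (Avoid t C)) ω
            in-half-open (above , below) =
                avoid-below s≤1 (All.map (λ above inside → above⇒≤ (above inside)) above)
              , hit-above (Any.map (λ (inside , below) → inside , below⇒< below) below)

          interior : ∀ ℓ {j ω} → mark ℓ R ≤ 1# → 0# ≤ width ℓ → j ℕ.< R → BothMinIn ℓ j ω → BothInMarks ℓ j ω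
          interior ℓ {j} markR≤1 0≤w j<R = both-in ℓ j
            (Order.trans (+-mono-≤ Order.refl (*-monoʳ-≤ 0≤w (fromℕ-mono-≤ (ℕ.<⇒≤ j<R)))) markR≤1) proj₂ proj₂

          0<R : 0 ℕ.< R
          0<R = ℕ.m^n>0 2 r

          -- Code 2 ^ r of a band is the point ε k, the left end of the first cell
          -- of the band above, or outside the bucket if k = 0.
          boundary : ∀ ℓ k {ω} → mark ℓ R ≈ ε k → top ℓ ≈ ε k → k ℕ.≤ K → BothMinIn ℓ R ω →
            ⋃-cells R BothInMarks ω
          boundary ℓ zero    mark≈ top≈ k≤K ((above , below) , _) =
            let above⇒ , (inside , _) = All.lookupAny above below
            in contradiction
                 (Order.trans (Order.reflexive (sym (trans mark≈ ε-zero))) (proj₂ (above⇒ inside)))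
                 (<⇒≱ (proj₂ inside))
          boundary ℓ (suc k) {ω} mark≈ top≈ k<K both = inj₁ (k , k<K , 0 , 0<R ,
            both-in ℓ R (Order.trans (Order.reflexive mark-0) (ε≤1 (suc k)))
              (λ (_ , mark≤) → Order.trans (Order.reflexive (trans mark-0 (sym mark≈))) mark≤)
              (λ {x} (x≤top , _) → begin-strict
                x                               ≤⟨ x≤top ⟩
                top ℓ                           ≈⟨ trans top≈ (sym (+-identityˡ (ε (suc k)))) ⟩
                0# + ε (suc k)                  <⟨ +-monoˡ-< (ε (suc k)) (*-pos (0<ε (suc k)) (0<ε r)) ⟩
                width (low k) + ε (suc k)       ≈⟨ solve 2 (λ w e → w :+ e := e :+ (:1 :+ :0) :* w) refl (width (low k)) (ε (suc k)) ⟩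
                mark (low k) 1                  ∎)
              both)
            where
            mark-0 : mark (low k) 0 ≈ ε (suc k)
            mark-0 = trans (+-congˡ (zeroˡ _)) (+-identityʳ _)

          -- Passes from R + 1 codes per band to R cells, so the extra codes cost no probability and
          -- the cell widths add up to the length of the band.
          cover : ⋃-cells (suc R) BothMinIn ⊆ ⋃-cells R BothInMarks
          cover {ω} (inj₁ (k , k<K , j , j<1+R , both)) = cases (ℕ.m<1+n⇒m<n∨m≡n j<1+R)
            where
            cases : j ℕ.< R ⊎ j ≡ R → ⋃-cells R BothInMarks ω
            cases (inj₁ j<R) = inj₁ (k , k<K , j , j<R ,
              interior (low k) (Order.trans (Order.reflexive (mark-low-R k)) (ε≤1 k)) (*-nonneg (0≤ε (suc k)) (0≤ε r)) j<R both)
            cases (inj₂ j≡R) = boundary (low k) k (mark-low-R k) refl (ℕ.<⇒≤ k<K) (≡.subst (λ j → BothMinIn (low k) j ω) j≡R both)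
          cover {ω} (inj₂ (j , j<1+R , both)) = cases (ℕ.m<1+n⇒m<n∨m≡n j<1+R)
            where
            cases : j ℕ.< R ⊎ j ≡ R → ⋃-cells R BothInMarks ω
            cases (inj₁ j<R) = inj₂ (j , j<R ,
              interior last (Order.trans (Order.reflexive mark-last-R) (ε≤1 K)) (*-nonneg (0≤ε K) (0≤ε r)) j<R both)
            cases (inj₂ j≡R) = boundary last K mark-last-R refl ℕ.≤-refl (≡.subst (λ j → BothMinIn last j ω) j≡R both)

        P-Collision : ℙ (Collision A B) ≤ ε r + fromℕ n * ε (p ℕ.+ 2 ℕ.^ q ℕ.+ r)
        P-Collision = begin
          ℙ (Collision A B)
            ≤⟨ P-mono (meas-Collision A B) (meas-⋃-cells R meas-BothInMarks)
                 (λ Z≡1 → cover (collision-cells Z≡1)) ⟩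
          ℙ (⋃-cells R BothInMarks)
            ≤⟨ P-∪-≤ (meas-⋃< K (λ k → meas-⋃< R (meas-BothInMarks (low k)))) (meas-⋃< R (meas-BothInMarks last)) ⟩
          ℙ (⋃< K (λ k → ⋃< R (BothInMarks (low k)))) + ℙ (⋃< R (BothInMarks last))
            ≤⟨ +-mono-≤ (P-⋃<-telescope K (λ k → ε r * F k) (λ k → meas-⋃< R (meas-BothInMarks (low k))) (λ k _ → P-low k)) P-last ⟩
          ε r * F K - ε r * F 0 + fromℕ n * ε (p ℕ.+ 2 ℕ.^ q ℕ.+ r)
            ≤⟨ +-monoˡ-≤ _ (begin
                 ε r * F K - ε r * F 0   ≤⟨ x-y≤x (*-nonneg (0≤ε r) (^-nonneg n (0≤clear (ε≤1 1)))) ⟩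
                 ε r * F K               ≤⟨ *-monoˡ-≤ (0≤ε r) (^-≤1 n (0≤clear (ε≤1 (suc K))) (clear≤1 (0≤ε (suc K)))) ⟩
                 ε r * 1#                ≈⟨ *-identityʳ (ε r) ⟩
                 ε r                     ∎) ⟩
          ε r + fromℕ n * ε (p ℕ.+ 2 ℕ.^ q ℕ.+ r) ∎

  𝔼-collisions≤ : ∀ {A B} → Unique A → Unique B → Disjoint A B →
    ∀ m d → length A ≡ suc (m ℕ.+ d) → length B ≡ m →
    𝔼-collisions ℛ 𝒫 p q r h A B ≤ collisionBound ℛ p q r (suc (m ℕ.+ d))
  𝔼-collisions≤ {A} {B} uA uB A#B m d ∣A∣ ∣B∣ = begin
    mean N (λ ω → ∑ {N} (λ i → Zᵢ (toℕ i) ω))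
      ≈⟨ mean-∑ N Z≤1 (λ i → meas-Collision i A B) ⟩
    sum {N} (λ i → ℙ (Collision (toℕ i) A B))
      ≤⟨ sum-bound N (λ i → ℙ (Collision i A B)) (λ i i<N → P-Collision i i<N uA uB A#B m d ∣A∣ ∣B∣) ⟩
    fromℕ N * (ε r + fromℕ n * ε (p ℕ.+ 2 ℕ.^ q ℕ.+ r))
      ≈⟨ *-congʳ (fromℕ-homo-^ 2 p) ⟩
    2^ (+ p) * (ε r + fromℕ n * ε (p ℕ.+ 2 ℕ.^ q ℕ.+ r))
      -- The argument yields coefficient 1 in front of 2⁻ʳ; it is enlarged to the stated 5.
      ≤⟨ *-monoˡ-≤ (proj₁ (0<2^ p)) (+-monoˡ-≤ _ εr≤5εr) ⟩
    2^ (+ p) * (fromℕ 5 * ε r + fromℕ n * ε (p ℕ.+ 2 ℕ.^ q ℕ.+ r)) ∎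
    where
    N = 2 ℕ.^ p
    n = suc (m ℕ.+ d)
    Zᵢ : ℕ → Ω → ℕ
    Zᵢ i ω = HyperMinHash.Z ℛ p q r (λ a → h a ω) A B i
    Z≤1 : ∀ i ω → Zᵢ i ω ℕ.≤ 1
    Z≤1 i ω = HyperMinHash.collide≤1 ℛ (HyperMinHash.sketch ℛ p q r (λ a → h a ω) A i)
                                       (HyperMinHash.sketch ℛ p q r (λ a → h a ω) B i)
    εr≤5εr : ε r ≤ fromℕ 5 * ε r
    εr≤5εr = begin
      ε r               ≈⟨ *-identityˡ (ε r) ⟨
      1# * ε r          ≤⟨ *-monoʳ-≤ (0≤ε r) (x≤x+y (fromℕ-nonneg 4)) ⟩
      fromℕ 5 * ε r     ∎

theorem1 : (ℛ : Reals) (𝒫 : ProbabilitySpace ℛ)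
    (𝕊 : Set) (h : 𝕊 → ProbabilitySpace.Ω 𝒫 → Reals.ℝ ℛ) → IsRandomHash ℛ 𝒫 h →
    (p q r n m : ℕ) (A B : List 𝕊) →
    Unique A → Unique B → Disjoint A B →
    length A ≡ n → length B ≡ m → n > m →
    Reals._≤_ ℛ (𝔼-collisions ℛ 𝒫 p q r h A B) (collisionBound ℛ p q r n)
-- `n > m` unfolds to `suc m ≤ n`, so n = suc (m + d), the form in which `paired-powers` uses the
-- gap d between m and n - 1.
theorem1 ℛ 𝒫 𝕊 h H p q r n m A B uA uB A#B ∣A∣ ∣B∣ n>m with ℕ.m≤n⇒∃[o]m+o≡n n>m
... | d , ≡.refl = RandomHash.𝔼-collisions≤ ℛ 𝒫 h H p q r uA uB A#B m d ∣A∣ ∣B∣
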